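{- Let $k$ be a positive integer and let $G$ be a $k$-multiple tree. Then there is a spanning tree factorization $(T_1,\ldots,T_k)$ of $G$ such that $|d_{T_i}(v)-d_{T_j}(v)|\leq 22\log(k)$ for all $v \in V(G)$ and $i,j \in \{1,\ldots,k\}$.
   Context: Graphs are finite and may have parallel edges. For a positive integer $k$, a graph $G$ is a $k$-multiple tree if there are spanning trees $T_1,\ldots,T_k$ of $G$ that are pairwise edge-disjoint and satisfy $E(T_1)\cup\cdots\cup E(T_k)=E(G)$; the tuple $(T_1,\ldots,T_k)$ is then called a spanning tree factorization of $G$. $d_T(v)$ denotes the number of edges of $T$ incident to $v$. $\log$ denotes the logarithm to base $2$. -}

module Defs where

open import Data.Nat using (ℕ; zero; suc; _+_; _*_; _^_; _≤_)
open import Data.Nat.DivMod using (_%_; m%n<n)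
open import Data.Fin using (Fin; toℕ; fromℕ<; _≟_)
open import Data.Bool using (Bool; true; false; if_then_else_)
open import Data.List using (List; map; allFin)
open import Data.Nat.ListAction using (sum)
open import Data.Product using (_×_; _,_; proj₁; proj₂; Σ; ∃)
open import Data.Sum using (_⊎_)
open import Relation.Binary.PropositionalEquality using (_≡_)
open import Relation.Nullary using (¬_; does)
open import Function.Definitions using (Injective)

-- A finite multigraph (parallel edges and loops allowed):
-- vertices Fin n, edges Fin m, each edge has an (unordered) pair of endpoints.
record Graph : Set where
  field
    n    : ℕ
    m    : ℕ
    ends : Fin m → Fin n × Fin n
open Graph public

Vertex : Graph → Set
Vertex G = Fin (n G)

Edge : Graph → Set
Edge G = Fin (m G)

EdgeSet : Graph → Set
EdgeSet G = Edge G → Bool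

Joins : (G : Graph) → Edge G → Vertex G → Vertex G → Set
Joins G e x y = (proj₁ (ends G e) ≡ x × proj₂ (ends G e) ≡ y)
              ⊎ (proj₁ (ends G e) ≡ y × proj₂ (ends G e) ≡ x)

data Walk (G : Graph) (S : EdgeSet G) : Vertex G → Vertex G → Set where
  [] : ∀ {v} → Walk G S v v
  step : ∀ {u w v} (e : Edge G) → S e ≡ true → Joins G e u w →
         Walk G S w v → Walk G S u v

Connected : (G : Graph) → EdgeSet G → Set
Connected G S = ∀ u v → Walk G S u v

next : ∀ {l} → Fin (suc l) → Fin (suc l)
next {l} i = fromℕ< (m%n<n (suc (toℕ i)) (suc l))

-- a cycle of length suc l in S: distinct vertices v_0..v_l, distinct edges
-- e_0..e_l of S, with e_i joining v_i and v_{i+1 mod (l+1)}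
-- (length 1 = loop, length 2 = pair of parallel edges)
record Cycle (G : Graph) (S : EdgeSet G) : Set where
  field
    l     : ℕ
    vs    : Fin (suc l) → Vertex G
    es    : Fin (suc l) → Edge G
    vsInj : Injective _≡_ _≡_ vs
    esInj : Injective _≡_ _≡_ es
    esInS : ∀ i → S (es i) ≡ true
    join  : ∀ i → Joins G (es i) (vs i) (vs (next i))

Acyclic : (G : Graph) → EdgeSet G → Set
Acyclic G S = ¬ Cycle G S

SpanningTree : (G : Graph) → EdgeSet G → Set
SpanningTree G S = Connected G S × Acyclic G S

IsSpanningTreeFactorization : (G : Graph) (k : ℕ) → (Fin k → EdgeSet G) → Set
IsSpanningTreeFactorization G k T =
    (∀ i → SpanningTree G (T i))
  × (∀ i j e → T i e ≡ true → T j e ≡ true → i ≡ j)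
  × (∀ e → ∃ λ i → T i e ≡ true)

MultipleTree : ℕ → Graph → Set
MultipleTree k G = Σ (Fin k → EdgeSet G) (IsSpanningTreeFactorization G k)

endsAt : (G : Graph) → Vertex G → Edge G → ℕ
endsAt G v e = (if does (proj₁ (ends G e) ≟ v) then 1 else 0)
             + (if does (proj₂ (ends G e) ≟ v) then 1 else 0)

degree : (G : Graph) → EdgeSet G → Vertex G → ℕ
degree G S v = sum (map (λ e → if S e then endsAt G v e else 0) (allFin (m G)))

∣_-_∣ : ℕ → ℕ → ℕ
∣ zero - b ∣ = b
∣ suc a - zero ∣ = suc a
∣ suc a - suc b ∣ = ∣ a - b ∣

-- d ≤ c · log₂ k  (real logarithm), for k ≥ 1, is equivalent to 2^d ≤ k^c
≤-c*log₂ : ℕ → ℕ → ℕ → Set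
≤-c*log₂ d c k = 2 ^ d ≤ k ^ c

module Submission where

-- Two spanning trees.  The edges of two spanning trees A and B can be redistributed so that at every vertex the
-- two degrees differ by at most 8.  Only big vertices, of degree at least 9 in A ∪ B, need attention.  Discharging
-- yields a vertex v of degree 2 or 3 with at most one big neighbour, or a vertex of degree 2 both of whose edges go
-- to the same vertex, or two vertices of degree 2 with a common big neighbour.  In each case v is removed, the
-- remaining graph is balanced by induction, and v is put back; for degree 3, where v subdivides an edge xy and is
-- joined to a third vertex z, there is a choice of the tree in which z gains an edge.
--
-- k spanning trees.  Write k = 2^t + r with r < 2^t.  Balancing pairs of trees along a butterfly network makes the
-- degrees in the first 2^t trees agree up to 8 t.  If r > 0, pairing the other r trees with some of these about
-- halves the spread W of the degrees: 2 W′ ≤ W + 16 t + 16.  Repeating this leaves a spread of at most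
-- 16 t + 16 ≤ 22 log k.

open import Defs hiding (n; m; ends)
open import Data.Bool using (true; false; if_then_else_)
open import Data.Fin using (Fin; zero; suc; punchIn; punchOut; _≟_; fromℕ; inject₁; toℕ; fromℕ<)
import Data.Fin.Properties as Fin
open import Data.Fin.Properties using (any?; punchInᵢ≢i; punchIn-injective; punchIn-punchOut; punchOut-punchIn)
open import Data.Fin.Induction using (<-weakInduction)
open import Data.Fin.Relation.Unary.Top as Top using (‵fromℕ; ‵inject₁)
open import Data.List using (List; []; _∷_; _++_; map; length; filter; allFin)
open import Data.List.Properties using (map-++; map-∘; map-id; length-map; length-++; length-filter; length-tabulate; ++-identityʳ)
open import Data.List.Membership.Propositional using (find) renaming (_∈_ to _∈ₚ_; _∉_ to _∉ₚ_)
import Data.List.Membership.Propositional.Properties as Memₚ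
open import Data.List.Membership.Propositional.Properties.WithK using (unique∧set⇒bag)
import Data.List.Membership.DecPropositional as DecMembership
import Data.List.Membership.Setoid as SetoidMembership
import Data.List.Membership.Setoid.Properties as Mem
open import Data.List.Relation.Binary.BagAndSetEquality using (∼bag⇒↭)
open import Data.List.Relation.Binary.Permutation.Homogeneous as Homogeneous using (prep)
open import Data.List.Relation.Binary.Permutation.Propositional using (↭ₛ⇒↭; ↭⇒↭ₛ)
  renaming (_↭_ to _↭ₚ_; ↭-trans to ↭ₚ-trans; ↭-refl to ↭ₚ-refl; ↭-sym to ↭ₚ-sym; prep to ↭ₚ-prep; swap to ↭ₚ-swap)
import Data.List.Relation.Binary.Permutation.Propositional.Properties as Permₚ
import Data.List.Relation.Binary.Permutation.Setoid as SetoidPermutation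
import Data.List.Relation.Binary.Permutation.Setoid.Properties as Perm
open import Data.List.Relation.Binary.Pointwise as Pointwise using (Pointwise; []; _∷_)
open import Data.List.Relation.Unary.All as All using (All; []; _∷_)
import Data.List.Relation.Unary.All.Properties as All
open import Data.List.Relation.Unary.Any as Any using (here; there)
import Data.List.Relation.Unary.Any.Properties as Any
open import Data.List.Relation.Unary.Unique.Propositional using (Unique; []; _∷_)
import Data.List.Relation.Unary.Unique.Propositional.Properties as Unique
open import Data.Nat using (ℕ; zero; suc; _+_; _*_; _∸_; _^_; _≤_; _<_; z≤n; s≤s; z<s; s<s; s<s⁻¹; s≤s⁻¹; _<ᵇ_; _≤?_; _<?_)
open import Data.Nat.DivMod using (_%_; n%n≡0; m<n⇒m%n≡m)
open import Data.Nat.ListAction using (sum)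
open import Data.Nat.ListAction.Properties using (sum-++; sum-↭)
open import Data.Nat.Properties renaming (_≟_ to _≟ℕ_) hiding (_≤?_; _<?_)
open import Data.Nat.Tactic.RingSolver using (solve-∀)
open import Data.Product using (_×_; _,_; proj₁; proj₂; Σ; ∃; ∃₂)
open import Data.Sum using (_⊎_; inj₁; inj₂; [_,_]′)
open import Data.Unit using (⊤; tt)
open import Function using (_∘_; id; case_of_; _⇔_; Equivalence; mk⇔)
open import Level using (0ℓ)
open import Relation.Binary using (Setoid; Rel)
open import Relation.Binary.Construct.Closure.ReflexiveTransitive using (Star; ε; _◅_; _◅◅_; reverse; kleisliStar; _⋆)
open import Relation.Binary.PropositionalEquality
open import Relation.Nullary using (¬_; Dec; yes; no; does; contradiction; ofʸ; ofⁿ)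
open import Relation.Nullary.Decidable using (toWitness)
import Algebra.Properties.CommutativeMonoid.Sum as CommutativeMonoidSum
open CommutativeMonoidSum +-0-commutativeMonoid using (∑-distrib-+; sum-cong-≗; sum-replicate-zero) renaming (sum to ∑)

-- A pair of trees can be brought close at all vertices at once, but the pair that most needs it
-- differs from vertex to vertex. The sequence of pairs is therefore fixed beforehand, from `k` and
-- the number of edges alone, and analysed for an arbitrary sequence of numbers: a step replaces two
-- entries by two entries with the same sum that differ by at most 8. The analysis then applies to
-- the degrees at every vertex simultaneously.
--
-- The bound 8 comes from the discharging. Two trees on n vertices have 2n - 2 edges, so the charges
-- 2 deg w - 8 sum to -8. Big vertices pay their neighbours of degree 2 and 3. A big vertex of
-- degree d pays at most d plus the number of its edges to vertices of degree 2; if it ends up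
-- negative, that number exceeds d - 8, hence is at least 2 once d is at least 9. All other vertices
-- have total degree at most 8, and there any distribution of the edges is good enough.

private variable
  n : ℕ

-- Multigraphs as lists of unordered pairs

Pair : ℕ → Set
Pair n = Fin n × Fin n

infix 4 _≐_
data _≐_ {n} : Rel (Pair n) 0ℓ where
  same : ∀ {e} → e ≐ e
  flip : ∀ {a b} → (a , b) ≐ (b , a)

unordered : ℕ → Setoid 0ℓ 0ℓ
unordered n = record
  { Carrier = Pair n
  ; _≈_ = _≐_
  ; isEquivalence = record { refl = same ; sym = ≐-sym ; trans = ≐-trans }
  }
  where
  ≐-sym : ∀ {e f : Pair n} → e ≐ f → f ≐ e
  ≐-sym same = same
  ≐-sym flip = flip
  ≐-trans : ∀ {e f g : Pair n} → e ≐ f → f ≐ g → e ≐ g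
  ≐-trans same q = q
  ≐-trans flip same = flip
  ≐-trans flip flip = same

module _ {n : ℕ} where
  open SetoidMembership (unordered n) public using (_∈_)
  open SetoidPermutation (unordered n) public using (_↭_; ↭-prep; ↭-swap; ↭-refl; ↭-sym; ↭-trans; ↭-reflexive)
  open Perm (unordered n) public using (∈-resp-↭; xs↭ys⇒|xs|≡|ys|; shift; ++⁺; ++⁺ʳ; ++-comm; drop-∷)

Edges : ℕ → Set
Edges n = List (Pair n)

≐-cases : ∀ {a b c d : Fin n} → (a , b) ≐ (c , d) → (a ≡ c × b ≡ d) ⊎ (a ≡ d × b ≡ c)
≐-cases same = inj₁ (refl , refl)
≐-cases flip = inj₂ (refl , refl)

∈-≐ : ∀ {e f : Pair n} {L} → e ≐ f → e ∈ L → f ∈ L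
∈-≐ = Mem.∈-resp-≈ (unordered _)

∈⇒↭ : ∀ {e : Pair n} {L} → e ∈ L → ∃ λ K → L ↭ e ∷ K
∈⇒↭ {e = e} {L} e∈L with Mem.∈-∃++ (unordered _) e∈L
... | as , bs , f , e≐f , eq =
  as ++ bs , ↭-trans (SetoidPermutation.↭-reflexive-≋ (unordered _) eq) (shift (Setoid.sym (unordered _) e≐f) as bs)

∈-++⁻ : ∀ {e : Pair n} L {K} → e ∈ L ++ K → e ∈ L ⊎ e ∈ K
∈-++⁻ = Mem.∈-++⁻ (unordered _)

Reach : Edges n → Rel (Fin n) 0ℓ
Reach L = Star λ a b → (a , b) ∈ L

edge : ∀ {L : Edges n} {a b} → (a , b) ∈ L → Reach L a b
edge e = e ◅ ε

reach-sym : ∀ {L : Edges n} {a b} → Reach L a b → Reach L b a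
reach-sym = reverse (∈-≐ flip)

reach-⊆ : ∀ {L K : Edges n} → (∀ {a b} → (a , b) ∈ L → Reach K a b) → ∀ {a b} → Reach L a b → Reach K a b
reach-⊆ f = f ⋆

reach-↭ : ∀ {L K : Edges n} → L ↭ K → ∀ {a b} → Reach L a b → Reach K a b
reach-↭ p = reach-⊆ λ e → edge (∈-resp-↭ p e)

Conn : Edges n → Set
Conn L = ∀ a b → Reach L a b

conn-↭ : ∀ {L K : Edges n} → L ↭ K → Conn L → Conn K
conn-↭ p c a b = reach-↭ p (c a b)

-- An edge count replaces acyclicity: it is invariant under permutation and changes predictably when
-- a vertex is removed, suppressed or put back. The equivalence with `SpanningTree` is proved
-- separately.
Tree : Edges n → Set
Tree {n} L = Conn L × suc (length L) ≡ n

tree-↭ : ∀ {L K : Edges n} → L ↭ K → Tree L → Tree K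
tree-↭ p (c , l) = conn-↭ p c , trans (cong suc (sym (xs↭ys⇒|xs|≡|ys| p))) l

-- Deleting one edge splits a path at its first use of that edge.
reach-∷ : ∀ {L : Edges n} {x y a} → Reach ((x , y) ∷ L) a x → Reach L a x ⊎ Reach L a y
reach-∷ ε = inj₁ ε
reach-∷ (here e ◅ r) with ≐-cases e
... | inj₁ (refl , _) = inj₁ ε
... | inj₂ (refl , _) = inj₂ ε
reach-∷ (there e ◅ r) = [ inj₁ ∘ (e ◅_) , inj₂ ∘ (e ◅_) ]′ (reach-∷ r)

-- The walk may begin with loops at `a`; these are skipped.
leave : ∀ {L : Edges n} {a b} → Reach L a b → a ≢ b → ∃ λ c → c ≢ a × (a , c) ∈ L
leave ε a≢b = contradiction refl a≢b
leave {a = a} (_◅_ {j = c} e r) a≢b with c ≟ a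
... | yes refl = leave r a≢b
... | no c≢a = c , c≢a , e

-- Removing and adding a vertex

up : Fin (suc n) → Pair n → Pair (suc n)
up v (a , b) = punchIn v a , punchIn v b

ups : Fin (suc n) → Edges n → Edges (suc n)
ups v = map (up v)

up-≐ : ∀ (v : Fin (suc n)) {e f} → e ≐ f → up v e ≐ up v f
up-≐ v same = same
up-≐ v flip = flip

ups-↭ : ∀ (v : Fin (suc n)) {L K} → L ↭ K → ups v L ↭ ups v K
ups-↭ v = Perm.map⁺ (unordered _) (unordered _) (up-≐ v)

ups-∈ : ∀ (v : Fin (suc n)) {e L} → e ∈ L → up v e ∈ ups v L
ups-∈ v = Mem.∈-map⁺ (unordered _) (unordered _) (up-≐ v)

ups-∈⁻ : ∀ (v : Fin (suc n)) {a b L} → (a , b) ∈ ups v L → ∃₂ λ c d → (c , d) ∈ L × a ≡ punchIn v c × b ≡ punchIn v d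
ups-∈⁻ v e with Mem.∈-map⁻ (unordered _) (unordered _) e
... | (c , d) , e′ , eq with ≐-cases eq
...   | inj₁ (p , q) = c , d , e′ , p , q
...   | inj₂ (p , q) = d , c , ∈-≐ flip e′ , p , q

data View (v : Fin (suc n)) : Fin (suc n) → Set where
  pivot : View v v
  other : ∀ u → View v (punchIn v u)

view : ∀ (v u : Fin (suc n)) → View v u
view v u with v ≟ u
... | yes refl = pivot
... | no v≢u = subst (View v) (punchIn-punchOut v≢u) (other (punchOut v≢u))

-- The contraction of `v` into `x`, a left inverse of `punchIn v`.
merge : Fin (suc n) → Fin n → Fin (suc n) → Fin n
merge v x u with v ≟ u
... | yes _ = x
... | no v≢u = punchOut v≢u

merge-pivot : ∀ (v : Fin (suc n)) x → merge v x v ≡ x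
merge-pivot v x with v ≟ v
... | yes _ = refl
... | no v≢v = contradiction refl v≢v

merge-other : ∀ (v : Fin (suc n)) x u → merge v x (punchIn v u) ≡ u
merge-other v x u with v ≟ punchIn v u
... | yes eq = contradiction (sym eq) (punchInᵢ≢i v u)
... | no v≢u = punchOut-punchIn v

contract : ∀ (v : Fin (suc n)) x {L K} → (∀ {a b} → (a , b) ∈ L → Reach K (merge v x a) (merge v x b)) → Conn L → Conn K
contract v x f c a b =
  subst₂ (Reach _) (merge-other v x a) (merge-other v x b)
    (kleisliStar (merge v x) f (c (punchIn v a) (punchIn v b)))

merge-ups : ∀ (v : Fin (suc n)) x {L a b} → (a , b) ∈ ups v L → Reach L (merge v x a) (merge v x b)
merge-ups v x e with ups-∈⁻ v e
... | c , d , e′ , refl , refl = subst₂ (Reach _) (sym (merge-other v x c)) (sym (merge-other v x d)) (edge e′)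

merge-edge : ∀ (v : Fin (suc n)) x {K y a b} → (a , b) ≐ (v , punchIn v y) → Reach K x y → Reach K (merge v x a)
  (merge v x b)
merge-edge v x {y = y} e r with ≐-cases e
... | inj₁ (refl , refl) = subst₂ (Reach _) (sym (merge-pivot v x)) (sym (merge-other v x y)) r
... | inj₂ (refl , refl) = subst₂ (Reach _) (sym (merge-other v x y)) (sym (merge-pivot v x)) (reach-sym r)

expand : ∀ (v : Fin (suc n)) x {L K} → (∀ {a b} → (a , b) ∈ K → Reach L (punchIn v a) (punchIn v b)) →
  Reach L v (punchIn v x) → Conn K → Conn L
expand v x {L} f r c a b = to-x a ◅◅ reach-sym (to-x b)
  where
  to-x : ∀ a → Reach L a (punchIn v x)
  to-x a with view v a
  ... | pivot = r
  ... | other u = kleisliStar (punchIn v) f (c u x)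

remove-leaf : ∀ (v : Fin (suc n)) {x L} → Tree ((v , punchIn v x) ∷ ups v L) → Tree L
remove-leaf v {x} {L} (c , l) = contract v x by c , suc-injective (trans (cong (2 +_) (sym (length-map (up v) L))) l)
  where
  by : ∀ {a b} → (a , b) ∈ (v , punchIn v x) ∷ ups v L → Reach L (merge v x a) (merge v x b)
  by (here e) = merge-edge v x e ε
  by (there e) = merge-ups v x e

add-leaf : ∀ (v : Fin (suc n)) {x L} → Tree L → Tree ((v , punchIn v x) ∷ ups v L)
add-leaf v {x} {L} (c , l) =
  expand v x (λ e → edge (there (ups-∈ v e))) (edge (here same)) c , cong suc (trans (cong suc (length-map (up v) L)) l)

suppress : ∀ (v : Fin (suc n)) {x y L} → Tree ((v , punchIn v x) ∷ (v , punchIn v y) ∷ ups v L) → Tree ((x , y) ∷ L)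
suppress v {x} {y} {L} (c , l) = contract v x by c , suc-injective (trans (cong (3 +_) (sym (length-map (up v) L))) l)
  where
  by : ∀ {a b} → (a , b) ∈ (v , punchIn v x) ∷ (v , punchIn v y) ∷ ups v L → Reach ((x , y) ∷ L) (merge v x a) (merge v x b)
  by (here e) = merge-edge v x e ε
  by (there (here e)) = merge-edge v x e (edge (here same))
  by (there (there e)) = reach-⊆ (edge ∘ there) (merge-ups v x e)

-- The second path may be attached at any vertex z which stays connected to y without the edge xy.
subdivide : ∀ (v : Fin (suc n)) {x y z L} → Reach L z y → Tree ((x , y) ∷ L) →
  Tree ((v , punchIn v x) ∷ (v , punchIn v z) ∷ ups v L)
subdivide v {x} {y} {z} {L} r (c , l) =
  expand v x by (edge (here same)) c , cong suc (trans (cong (2 +_) (length-map (up v) L)) l)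
  where
  K = (v , punchIn v x) ∷ (v , punchIn v z) ∷ ups v L
  old : ∀ {a b} → Reach L a b → Reach K (punchIn v a) (punchIn v b)
  old = kleisliStar (punchIn v) λ e → edge (there (there (ups-∈ v e)))
  path : Reach K (punchIn v x) (punchIn v y)
  path = here flip ◅ there (here same) ◅ old r
  by : ∀ {a b} → (a , b) ∈ (x , y) ∷ L → Reach K (punchIn v a) (punchIn v b)
  by (here e) with ≐-cases e
  ... | inj₁ (refl , refl) = path
  ... | inj₂ (refl , refl) = reach-sym path
  by (there e) = old (edge e)

-- Degrees

-- Written in the shape of `endsAt`, so that `deg` of a list of labelled edges unfolds to the sum in
-- `degree`; a loop counts twice in both.
at : Fin n → Fin n → ℕ → ℕ
at a w k = if does (a ≟ w) then k else 0

at-same : ∀ (a : Fin n) k → at a a k ≡ k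
at-same a k with a ≟ a
... | yes _ = refl
... | no a≢a = contradiction refl a≢a

at-diff : ∀ {a w : Fin n} k → a ≢ w → at a w k ≡ 0
at-diff {a = a} {w} k a≢w with a ≟ w
... | yes a≡w = contradiction a≡w a≢w
... | no _ = refl

at-punchIn : ∀ (v : Fin (suc n)) a w k → at (punchIn v a) (punchIn v w) k ≡ at a w k
at-punchIn v a w k with a ≟ w
... | yes refl = at-same (punchIn v a) k
... | no a≢w = at-diff k (a≢w ∘ punchIn-injective v a w)

at-pivot : ∀ (v : Fin (suc n)) u k → at v (punchIn v u) k ≡ 0
at-pivot v u k = at-diff k (punchInᵢ≢i v u ∘ sym)

at-pivotʳ : ∀ (v : Fin (suc n)) u k → at (punchIn v u) v k ≡ 0
at-pivotʳ v u k = at-diff k (punchInᵢ≢i v u)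

half : (Fin n → ℕ) → Fin n → Pair n → ℕ
half f w (a , b) = at a w (f b) + at b w (f a)

-- The sum of f over the neighbours of w, with multiplicity.
nb : (Fin n → ℕ) → Edges n → Fin n → ℕ
nb f L w = sum (map (half f w) L)

deg : Edges n → Fin n → ℕ
deg = nb λ _ → 1

nb-↭ : ∀ (f : Fin n → ℕ) {L K} w → L ↭ K → nb f L w ≡ nb f K w
nb-↭ f w p = sum-↭ (↭ₛ⇒↭ (Perm.map⁺ (unordered _) (setoid ℕ) half-≐ p))
  where
  half-≐ : ∀ {d e} → d ≐ e → half f w d ≡ half f w e
  half-≐ same = refl
  half-≐ (flip {a} {b}) = +-comm (at a w (f b)) _

nb-++ : ∀ (f : Fin n → ℕ) L K w → nb f (L ++ K) w ≡ nb f L w + nb f K w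
nb-++ f L K w = trans (cong sum (map-++ (half f w) L K)) (sum-++ (map (half f w) L) _)

nb-ups : ∀ (v : Fin (suc n)) f L w → nb f (ups v L) (punchIn v w) ≡ nb (f ∘ punchIn v) L w
nb-ups v f [] w = refl
nb-ups v f ((a , b) ∷ L) w = cong₂ _+_ (cong₂ _+_ (at-punchIn v a w _) (at-punchIn v b w _)) (nb-ups v f L w)

nb-ups-pivot : ∀ (v : Fin (suc n)) f L → nb f (ups v L) v ≡ 0
nb-ups-pivot v f [] = refl
nb-ups-pivot v f ((a , b) ∷ L) = cong₂ _+_ (cong₂ _+_ (at-pivotʳ v a _) (at-pivotʳ v b _)) (nb-ups-pivot v f L)

nb-∷-end : ∀ (f : Fin n → ℕ) {w x} L → x ≢ w → nb f ((w , x) ∷ L) w ≡ f x + nb f L w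
nb-∷-end f {w} {x} L x≢w =
  cong (_+ nb f L w) (trans (cong₂ _+_ (at-same w _) (at-diff _ x≢w)) (+-identityʳ (f x)))

nb-leaf-pivot : ∀ (v : Fin (suc n)) f x L → nb f ((v , punchIn v x) ∷ ups v L) v ≡ f (punchIn v x)
nb-leaf-pivot v f x L =
  trans (nb-∷-end f (ups v L) (punchInᵢ≢i v x)) (trans (cong (f (punchIn v x) +_) (nb-ups-pivot v f L)) (+-identityʳ _))

deg-∷-pivot : ∀ (v : Fin (suc n)) x L u → deg ((v , punchIn v x) ∷ L) (punchIn v u) ≡ at x u 1 + deg L (punchIn v u)
deg-∷-pivot v x L u = cong₂ (λ a b → a + b + deg L (punchIn v u)) (at-pivot v u 1) (at-punchIn v x u 1)

deg-leaf : ∀ (v : Fin (suc n)) x L u → deg ((v , punchIn v x) ∷ ups v L) (punchIn v u) ≡ at x u 1 + deg L u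
deg-leaf v x L u = trans (deg-∷-pivot v x (ups v L) u) (cong (at x u 1 +_) (nb-ups v _ L u))

deg-path : ∀ (v : Fin (suc n)) x y L u →
  deg ((v , punchIn v x) ∷ (v , punchIn v y) ∷ ups v L) (punchIn v u) ≡ at x u 1 + (at y u 1 + deg L u)
deg-path v x y L u = trans (deg-∷-pivot v x ((v , punchIn v y) ∷ ups v L) u) (cong (at x u 1 +_) (deg-leaf v y L u))

∈⇒deg>0 : ∀ {L : Edges n} {a b} → (a , b) ∈ L → 0 < deg L a
∈⇒deg>0 {L = L} {a} {b} e with ∈⇒↭ e
... | K , p = ≤-trans (≤-trans (≤-reflexive (sym (at-same a 1))) (≤-trans (m≤m+n _ _) (m≤m+n _ _)))
  (≤-reflexive (sym (nb-↭ _ a p)))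

conn⇒deg>0 : ∀ {L : Edges n} {a b} → Conn L → a ≢ b → 0 < deg L a
conn⇒deg>0 c a≢b = ∈⇒deg>0 (proj₂ (proj₂ (leave (c _ _) a≢b)))

deg0⇒ups : ∀ (v : Fin (suc n)) L → deg L v ≡ 0 → ∃ λ K → L ≡ ups v K
deg0⇒ups v [] _ = [] , refl
deg0⇒ups v ((a , b) ∷ L) d with view v a | view v b
... | pivot | _ = contradiction (trans (cong (λ k → k + at b v 1 + deg L v) (sym (at-same v 1))) d) λ ()
... | other _ | pivot = contradiction (m+n≡0⇒m≡0 _ d) (1+n≢0 ∘ trans (sym (trans (cong (at a v 1 +_)
  (at-same v 1)) (+-comm _ 1))))
... | other a′ | other b′ with deg0⇒ups v L (m+n≡0⇒n≡0 (at a v 1 + at b v 1) d)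
...   | K , refl = (a′ , b′) ∷ K , refl

nb>0 : ∀ (f : Fin n → ℕ) L w → 0 < nb f L w → ∃ λ x → 0 < f x × (w , x) ∈ L
nb>0 f ((a , b) ∷ L) w lt with a ≟ w | b ≟ w
... | no _ | no _ = let x , fx , e = nb>0 f L w lt in x , fx , there e
... | yes refl | no _ with f b in eq
...   | zero = let x , fx , e = nb>0 f L w lt in x , fx , there e
...   | suc _ = b , subst (0 <_) (sym eq) z<s , here same
nb>0 f ((a , b) ∷ L) w lt | no _ | yes refl with f a in eq
...   | zero = let x , fx , e = nb>0 f L w lt in x , fx , there e
...   | suc _ = a , subst (0 <_) (sym eq) z<s , here flip
nb>0 f ((a , b) ∷ L) w lt | yes refl | yes refl with f w in eq
...   | zero = let x , fx , e = nb>0 f L w lt in x , fx , there e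
...   | suc _ = w , subst (0 <_) (sym eq) z<s , here same

-- Balanced pairs of trees

Close : ℕ → ℕ → Set
Close a b = a ≤ b + 8 × b ≤ a + 8

close-small : ∀ {a b} → a + b ≤ 8 → Close a b
close-small {a} {b} le = ≤-trans (≤-trans (m≤m+n a b) le) (m≤n+m 8 b) , ≤-trans (≤-trans (m≤n+m b a) le) (m≤n+m 8 a)

close-suc : ∀ c {a b} → Close a b → Close (c + a) (c + b)
close-suc c {a} {b} (p , q) =
  ≤-trans (+-monoʳ-≤ c p) (≤-reflexive (sym (+-assoc c b 8))) , ≤-trans (+-monoʳ-≤ c q) (≤-reflexive (sym (+-assoc c a 8)))

close-add : ∀ {a b} → Close a b → a ≤ b → Close (1 + a) b
close-add {a} {b} (_ , q) a≤b = ≤-trans (s≤s a≤b) (≤-trans (≤-reflexive (+-comm 1 b)) (+-monoʳ-≤ b {1} {8}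
  (s≤s z≤n))) , ≤-trans q (n≤1+n _)

record Balanced (A B : Edges n) : Set where
  constructor balanced
  field
    {A′ B′} : Edges n
    treeA : Tree A′
    treeB : Tree B′
    perm : A′ ++ B′ ↭ A ++ B
    close : ∀ u → Close (deg A′ u) (deg B′ u)

balanced-↭ : ∀ {A B C D : Edges n} → A ++ B ↭ C ++ D → Balanced A B → Balanced C D
balanced-↭ p (balanced s t q c) = balanced s t (↭-trans q p) c

balanced-sym : ∀ {A B : Edges n} → Balanced A B → Balanced B A
balanced-sym {A = A} {B} = balanced-↭ (++-comm A B)

-- Balancing may put the auxiliary edge `e` into either tree. Since closeness is symmetric, the tree
-- that contains it can be named first.
locate : ∀ {e : Pair n} {A B} → Balanced (e ∷ A) B → ∃₂ λ S C →
  Tree (e ∷ S) × Tree C × (S ++ C ↭ A ++ B) × ∀ u → Close (deg (e ∷ S) u) (deg C u)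
locate {e = e} (balanced {A′} {B′} s t p c) with ∈-++⁻ A′ (∈-resp-↭ (↭-sym p) (here same))
... | inj₁ e∈A = let S , q = ∈⇒↭ e∈A in
  S , B′ , tree-↭ q s , t , drop-∷ (↭-trans (++⁺ʳ B′ (↭-sym q)) p) ,
  λ u → subst (λ d → Close d (deg B′ u)) (nb-↭ _ u q) (c u)
... | inj₂ e∈B = let S , q = ∈⇒↭ e∈B in
  S , A′ , tree-↭ q t , s , drop-∷ (↭-trans (++⁺ʳ A′ (↭-sym q)) (↭-trans (++-comm B′ A′) p)) ,
  λ u → let l , r = c u in subst (λ d → Close d (deg A′ u)) (nb-↭ _ u q) (r , l)

-- Redistribution preserves the total degree of `u`, and neither part can exceed that total.
small : ∀ {A B A′ B′ : Edges n} → A′ ++ B′ ↭ A ++ B → ∀ u → deg (A ++ B) u ≤ 8 → Close (deg A′ u) (deg B′ u)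
small {A = A} {B} {A′} {B′} p u d =
  close-small (≤-trans (≤-reflexive (trans (sym (nb-++ _ A′ B′ u)) (nb-↭ _ u p))) d)

-- Putting back a removed vertex

module _ (v : Fin (suc n)) where

  private
    p = punchIn v

    infixr 5 _◂_
    _◂_ : Fin n → Edges (suc n) → Edges (suc n)
    x ◂ L = (v , p x) ∷ L

  ups-++ : ∀ S C A B → S ++ C ↭ A ++ B → ups v S ++ ups v C ↭ ups v A ++ ups v B
  ups-++ S C A B q =
    ↭-trans (↭-reflexive (sym (map-++ (up v) S C))) (↭-trans (ups-↭ v q) (↭-reflexive (map-++ (up v) A B)))

  -- If `x ≡ y`, both degrees of this vertex grow by one. If `x` is small, its edge may go to either
  -- tree, so the edge to `y` is free to go where `y` has the smaller degree.
  insert-leaf-leaf : ∀ {x y A B} → deg ((x ◂ ups v A) ++ (y ◂ ups v B)) (p x) ≤ 8 ⊎ x ≡ y →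
    Balanced A B → Balanced (x ◂ ups v A) (y ◂ ups v B)
  insert-leaf-leaf {x} {y} {A} {B} h (balanced {A′} {B′} s t q c) = go h
    where
    pivot-close : ∀ x y C D → Close (deg (x ◂ ups v C) v) (deg (y ◂ ups v D) v)
    pivot-close x y C D rewrite nb-leaf-pivot v (λ _ → 1) x C | nb-leaf-pivot v (λ _ → 1) y D = s≤s z≤n , s≤s z≤n

    perm-xy : (x ◂ ups v A′) ++ (y ◂ ups v B′) ↭ (x ◂ ups v A) ++ (y ◂ ups v B)
    perm-xy = ↭-prep _ (↭-trans (Perm.↭-shift (unordered _) (ups v A′) _)
      (↭-trans (↭-prep _ (ups-++ A′ B′ A B q)) (↭-sym (Perm.↭-shift (unordered _) (ups v A) _))))

    perm-yx : (y ◂ ups v A′) ++ (x ◂ ups v B′) ↭ (x ◂ ups v A) ++ (y ◂ ups v B)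
    perm-yx = ↭-trans (Perm.↭-shift (unordered _) (y ◂ ups v A′) _)
      (↭-prep _ (↭-trans (↭-prep _ (ups-++ A′ B′ A B q)) (↭-sym (Perm.↭-shift (unordered _) (ups v A) _))))

    go : deg ((x ◂ ups v A) ++ (y ◂ ups v B)) (p x) ≤ 8 ⊎ x ≡ y → Balanced (x ◂ ups v A) (y ◂ ups v B)
    go (inj₂ refl) = balanced (add-leaf v s) (add-leaf v t) perm-xy by
      where
      by : ∀ u → Close (deg (x ◂ ups v A′) u) (deg (x ◂ ups v B′) u)
      by u with view v u
      ... | pivot = pivot-close x x A′ B′
      ... | other u rewrite deg-leaf v x A′ u | deg-leaf v x B′ u = close-suc (at x u 1) (c u)
    go (inj₁ d) with ≤-total (deg A′ y) (deg B′ y)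
    ... | inj₁ le = balanced (add-leaf v s) (add-leaf v t) perm-yx by
      where
      by : ∀ u → Close (deg (y ◂ ups v A′) u) (deg (x ◂ ups v B′) u)
      by u with view v u
      ... | pivot = pivot-close y x A′ B′
      ... | other u with x ≟ u
      ...   | yes refl = small {A = x ◂ ups v A} {A′ = y ◂ ups v A′} perm-yx (p x) d
      ...   | no x≢u rewrite deg-leaf v y A′ u | deg-leaf v x B′ u | at-diff 1 x≢u with y ≟ u
      ...     | yes refl = close-add (c y) le
      ...     | no _ = c u
    ... | inj₂ ge = balanced (add-leaf v s) (add-leaf v t) perm-xy by
      where
      by : ∀ u → Close (deg (x ◂ ups v A′) u) (deg (y ◂ ups v B′) u)
      by u with view v u
      ... | pivot = pivot-close x y A′ B′
      ... | other u with x ≟ u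
      ...   | yes refl = small {A = x ◂ ups v A} {A′ = x ◂ ups v A′} perm-xy (p x) d
      ...   | no x≢u rewrite deg-leaf v x A′ u | deg-leaf v y B′ u | at-diff 1 x≢u with y ≟ u
      ...     | yes refl = let l , r = close-add (let l , r = c y in r , l) ge in r , l
      ...     | no _ = c u

  -- The edge xy of the balanced trees stands for the path through `v`. If `z` is small, the path is
  -- simply restored and the edge to `z` goes to the other tree. If `x` and `y` are small, their
  -- edges may change trees, and `z` can gain its edge where its degree is smaller.
  insert-path-leaf : ∀ {x y z A B} →
    let G = (x ◂ y ◂ ups v A) ++ (z ◂ ups v B) in
    deg G (p z) ≤ 8 ⊎ deg G (p x) ≤ 8 × deg G (p y) ≤ 8 →
    Balanced ((x , y) ∷ A) B → Balanced (x ◂ y ◂ ups v A) (z ◂ ups v B)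
  insert-path-leaf {x} {y} {z} {A} {B} h b with locate b
  ... | S , C , s , t , q , c = go h
    where
    G = (x ◂ y ◂ ups v A) ++ (z ◂ ups v B)

    deg-v : deg G v ≤ 8
    deg-v = ≤-trans (≤-reflexive (trans (nb-++ _ (x ◂ y ◂ ups v A) (z ◂ ups v B) v) (cong₂ _+_
      (trans (nb-∷-end _ (y ◂ ups v A) (punchInᵢ≢i v x)) (cong suc (nb-leaf-pivot v _ y A)))
      (nb-leaf-pivot v _ z B)))) (s≤s (s≤s (s≤s z≤n)))

    small′ : ∀ A′ {B′} → A′ ++ B′ ↭ G → ∀ u → deg G u ≤ 8 → Close (deg A′ u) (deg B′ u)
    small′ A′ = small {A = x ◂ y ◂ ups v A} {A′ = A′}

    to-front : ∀ {a b c} → (a ◂ b ◂ ups v S) ++ (c ◂ ups v C) ↭ c ◂ a ◂ b ◂ (ups v A ++ ups v B)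
    to-front = ↭-trans (Perm.↭-shift (unordered _) (_ ◂ _ ◂ ups v S) _) (↭-prep _ (↭-prep _ (↭-prep _ (ups-++ S C A B q))))

    from-front : z ◂ x ◂ y ◂ (ups v A ++ ups v B) ↭ G
    from-front = ↭-sym (Perm.↭-shift (unordered _) (x ◂ y ◂ ups v A) _)

    perm-xyz : (x ◂ y ◂ ups v S) ++ (z ◂ ups v C) ↭ G
    perm-xyz = ↭-trans to-front from-front

    perm-xzy : (x ◂ z ◂ ups v S) ++ (y ◂ ups v C) ↭ G
    perm-xzy = ↭-trans to-front (↭-trans (↭-prep _ (↭-swap _ _ ↭-refl)) (↭-trans (↭-swap _ _ ↭-refl) (↭-trans
      (↭-prep _ (↭-swap _ _ ↭-refl)) from-front)))

    perm-yzx : (y ◂ z ◂ ups v S) ++ (x ◂ ups v C) ↭ G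
    perm-yzx = ↭-trans to-front (↭-trans (↭-prep _ (↭-swap _ _ ↭-refl)) (↭-trans (↭-swap _ _ ↭-refl) from-front))

    same-side : Close (deg (x ◂ y ◂ ups v S) (p z)) (deg (z ◂ ups v C) (p z)) →
      Balanced (x ◂ y ◂ ups v A) (z ◂ ups v B)
    same-side cz = balanced (subdivide v ε s) (add-leaf v t) perm-xyz by
      where
      by : ∀ u → Close (deg (x ◂ y ◂ ups v S) u) (deg (z ◂ ups v C) u)
      by u with view v u
      ... | pivot = small′ (x ◂ y ◂ ups v S) perm-xyz v deg-v
      ... | other u with z ≟ u
      ...   | yes refl = cz
      ...   | no z≢u rewrite deg-path v x y S u | deg-leaf v z C u | at-diff 1 z≢u =
        subst (λ d → Close d (deg C u)) (+-assoc (at x u 1) _ _) (c u)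

    -- Here `a` and `b` are the ends of xy in either order. The tree of xy receives the path from
    -- `a` over `v` to `z`, and the other tree the edge to `b`. So `b` trades an edge of one tree
    -- for an edge of the other, which its smallness permits.
    other-side : ∀ a b → (∀ u → deg ((a , b) ∷ S) u ≡ deg ((x , y) ∷ S) u) →
      (a ◂ z ◂ ups v S) ++ (b ◂ ups v C) ↭ G → Tree (a ◂ z ◂ ups v S) →
      deg G (p a) ≤ 8 → deg G (p b) ≤ 8 → deg ((x , y) ∷ S) z ≤ deg C z → Balanced (x ◂ y ◂ ups v A) (z ◂ ups v B)
    other-side a b eq r tree da db le = balanced tree (add-leaf v t) r by
      where
      by : ∀ u → Close (deg (a ◂ z ◂ ups v S) u) (deg (b ◂ ups v C) u)
      by u with view v u
      ... | pivot = small′ (a ◂ z ◂ ups v S) r v deg-v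
      ... | other u with a ≟ u | b ≟ u
      ...   | yes refl | _ = small′ (a ◂ z ◂ ups v S) r (p a) da
      ...   | no _ | yes refl = small′ (a ◂ z ◂ ups v S) r (p b) db
      ...   | no a≢u | no b≢u rewrite deg-path v a z S u | deg-leaf v b C u | at-diff 1 a≢u | at-diff 1 b≢u with z ≟ u
      ...     | yes refl = close-add (subst (λ d → Close d (deg C u)) eqᵤ (c u)) (≤-trans (≤-reflexive (sym eqᵤ)) le)
        where
        eqᵤ : deg ((x , y) ∷ S) u ≡ deg S u
        eqᵤ = trans (sym (eq u)) (cong₂ (λ i j → i + j + deg S u) (at-diff 1 a≢u) (at-diff 1 b≢u))
      ...     | no _ = subst (λ d → Close d (deg C u)) (trans (sym (eq u)) (cong₂ (λ i j → i + j + deg S u)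
        (at-diff 1 a≢u) (at-diff 1 b≢u))) (c u)

    go : deg G (p z) ≤ 8 ⊎ deg G (p x) ≤ 8 × deg G (p y) ≤ 8 → Balanced (x ◂ y ◂ ups v A) (z ◂ ups v B)
    go (inj₁ dz) = same-side (small′ (x ◂ y ◂ ups v S) perm-xyz (p z) dz)
    go (inj₂ (dx , dy)) with ≤-total (deg C z) (deg ((x , y) ∷ S) z)
    ... | inj₁ ge = same-side (subst₂ Close
      (trans (+-assoc (at x z 1) _ _) (sym (deg-path v x y S z)))
      (sym (trans (deg-leaf v z C z) (cong (_+ deg C z) (at-same z 1))))
      (let l , r = c z ; l′ , r′ = close-add (r , l) ge in r′ , l′))
    -- Deleting xy leaves `z` connected to one of its ends. The new path has to start at the
    -- opposite end in order to reconnect the two sides; the end on the side of `z` gets the leaf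
    -- edge.
    ... | inj₂ le with reach-∷ (proj₁ s z x)
    ...   | inj₂ zy = other-side x y (λ _ → refl) perm-xzy (subdivide v zy s) dx dy le
    ...   | inj₁ zx = other-side y x (λ u → nb-↭ _ u yx) perm-yzx (subdivide v zx (tree-↭ (↭-sym yx) s)) dy dx le
      where
      yx : (y , x) ∷ S ↭ (x , y) ∷ S
      yx = prep flip ↭-refl

-- Discharging

∑-const : ∀ n k → ∑ {n} (λ _ → k) ≡ n * k
∑-const zero k = refl
∑-const (suc n) k = cong (k +_) (∑-const n k)

∑-mono : ∀ {f g : Fin n → ℕ} → (∀ w → f w ≤ g w) → ∑ f ≤ ∑ g
∑-mono {n = zero} le = z≤n
∑-mono {n = suc n} le = +-mono-≤ (le zero) (∑-mono (le ∘ suc))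

∑-at : ∀ (g : Fin n → ℕ) a k → ∑ (λ w → g w * at a w k) ≡ g a * k
∑-at {n = suc n} g zero k =
  trans (cong (g zero * k +_) (trans (sum-cong-≗ (λ w → *-zeroʳ (g (suc w)))) (sum-replicate-zero n))) (+-identityʳ _)
∑-at {n = suc n} g (suc a) k = trans (cong (_+ ∑ (λ w → g (suc w) * at a w k)) (*-zeroʳ (g zero))) (∑-at (g ∘ suc) a k)

cross : (Fin n → ℕ) → (Fin n → ℕ) → Edges n → ℕ
cross f g [] = 0
cross f g ((a , b) ∷ L) = f a * g b + f b * g a + cross f g L

-- Conservation of charge: what all vertices together receive equals what they send.
cross-comm : ∀ (f g : Fin n → ℕ) L → cross f g L ≡ cross g f L
cross-comm f g [] = refl
cross-comm f g ((a , b) ∷ L) = cong₂ _+_ (trans (+-comm (f a * g b) _) (cong₂ _+_ (*-comm (f b) _) (*-comm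
  (f a) _))) (cross-comm f g L)

∑-nb : ∀ (g f : Fin n → ℕ) L → ∑ (λ w → g w * nb f L w) ≡ cross g f L
∑-nb {n} g f [] = trans (sum-cong-≗ (λ w → *-zeroʳ (g w))) (sum-replicate-zero n)
∑-nb g f ((a , b) ∷ L) =
  trans (sum-cong-≗ λ w → trans (*-distribˡ-+ (g w) _ _) (cong (_+ g w * nb f L w) (*-distribˡ-+ (g w) _ _)))
  (trans (∑-distrib-+ (λ w → g w * at a w (f b) + g w * at b w (f a)) (λ w → g w * nb f L w))
  (cong₂ _+_ (trans (∑-distrib-+ (λ w → g w * at a w (f b)) _) (cong₂ _+_ (∑-at g a (f b)) (∑-at g b (f a)))) (∑-nb g f L)))

∑-deg : ∀ (L : Edges n) → ∑ (λ w → 2 * deg L w) ≡ 4 * length L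
∑-deg L = trans (∑-nb (λ _ → 2) (λ _ → 1) L) (count L)
  where
  count : ∀ L → cross (λ _ → 2) (λ _ → 1) L ≡ 4 * length L
  count [] = refl
  count (_ ∷ L) = trans (cong (4 +_) (count L)) (sym (*-suc 4 (length L)))

-- A vertex whose charge 2 deg w - 8, corrected by what it receives from and sends to its neighbours, is negative.
deficient : ∀ {A B : Edges n} → Tree A → Tree B → ∀ (f g : Fin n → ℕ) → 0 < n →
  ∃ λ w → 2 * deg (A ++ B) w + f w * nb g (A ++ B) w < 8 + g w * nb f (A ++ B) w
deficient {n} {A} {B} (_ , la) (_ , lb) f g n>0
  with any? (λ w → 2 * deg (A ++ B) w + f w * nb g (A ++ B) w <? 8 + g w * nb f (A ++ B) w)
... | yes found = found
... | no none = contradiction total (<⇒≱ lt)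
  where
  G = A ++ B
  total : n * 8 + cross g f G ≤ 4 * length G + cross f g G
  total = subst₂ _≤_
    (trans (∑-distrib-+ {n} (λ _ → 8) _) (cong₂ _+_ (∑-const n 8) (∑-nb g f G)))
    (trans (∑-distrib-+ {n} (λ w → 2 * deg G w) _) (cong₂ _+_ (∑-deg G) (∑-nb f g G)))
    (∑-mono λ w → ≮⇒≥ λ lt → none (w , lt))
  -- The initial charges sum to 4 (2n - 2) - 8n = -8, so not all final charges can be nonnegative.
  length-G : 4 * length G + 8 ≡ n * 8
  length-G = begin
    4 * length G + 8                     ≡⟨ cong (λ l → 4 * l + 8) (length-++ A) ⟩
    4 * (length A + length B) + 8        ≡⟨ arith (length A) (length B) ⟩
    4 * suc (length A) + 4 * suc (length B) ≡⟨ cong₂ (λ a b → 4 * a + 4 * b) la lb ⟩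
    4 * n + 4 * n                        ≡⟨ arith′ n ⟩
    n * 8                                ∎
    where
    open ≡-Reasoning
    arith : ∀ a b → 4 * (a + b) + 8 ≡ 4 * suc a + 4 * suc b
    arith = solve-∀
    arith′ : ∀ a → 4 * a + 4 * a ≡ a * 8
    arith′ = solve-∀
  lt : 4 * length G + cross f g G < n * 8 + cross g f G
  lt = subst₂ (λ a b → 4 * length G + a < b + cross g f G) (cross-comm g f G) length-G
    (+-monoˡ-< (cross g f G) (m<m+n (4 * length G) z<s))

nb-≤ : ∀ {f g : Fin n → ℕ} → (∀ x → f x ≤ 1 + g x) → ∀ L w → nb f L w ≤ deg L w + nb g L w
nb-≤ le [] w = z≤n
nb-≤ {f = f} {g} le ((a , b) ∷ L) w =
  ≤-trans (+-mono-≤ (+-mono-≤ (at-≤ a (le b)) (at-≤ b (le a))) (nb-≤ le L w))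
    (≤-reflexive (arith (at a w 1) (at b w 1) _ _ _ _))
  where
  at-≤ : ∀ a {k l} → k ≤ 1 + l → at a w k ≤ at a w 1 + at a w l
  at-≤ a le with does (a ≟ w)
  ... | true = le
  ... | false = z≤n
  arith : ∀ a b c d e f → a + c + (b + d) + (e + f) ≡ a + b + e + (c + d + f)
  arith = solve-∀

-- Vertices of degree two and three

star : ∀ {L : Edges (2 + n)} → Tree L → ∀ v → ∃₂ λ x K → L ↭ (v , punchIn v x) ∷ K
star (c , _) v with leave (c v (punchIn v zero)) (punchInᵢ≢i v zero ∘ sym)
... | u , u≢v , e with view v u
...   | pivot = contradiction refl u≢v
...   | other x = x , ∈⇒↭ e

record Degree2 (v : Fin (2 + n)) (A B : Edges (2 + n)) : Set where
  field
    x y : Fin (suc n)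
    A₀ B₀ : Edges (suc n)
    permA : A ↭ (v , punchIn v x) ∷ ups v A₀
    permB : B ↭ (v , punchIn v y) ∷ ups v B₀

record Degree3 (v : Fin (2 + n)) (A B : Edges (2 + n)) : Set where
  field
    x y z : Fin (suc n)
    A₀ B₀ : Edges (suc n)
    permA : A ↭ (v , punchIn v x) ∷ (v , punchIn v y) ∷ ups v A₀
    permB : B ↭ (v , punchIn v z) ∷ ups v B₀

deg-star : ∀ {v : Fin (suc n)} {x K L} → L ↭ (v , punchIn v x) ∷ K → deg L v ≡ 1 + deg K v
deg-star {v = v} {x} {K} p = trans (nb-↭ _ v p) (nb-∷-end _ K (punchInᵢ≢i v x))

degree2 : ∀ {A B : Edges (2 + n)} → Tree A → Tree B → ∀ v → deg (A ++ B) v ≡ 2 → Degree2 v A B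
degree2 {A = A} {B} s t v d with star s v | star t v
... | x , K , p | y , M , q = go (deg0⇒ups v K (m+n≡0⇒m≡0 _ d0)) (deg0⇒ups v M (m+n≡0⇒n≡0 (deg K v) d0))
  where
  d0 : deg K v + deg M v ≡ 0
  d0 = suc-injective (suc-injective (trans (cong suc (sym (+-suc (deg K v) _)))
    (trans (sym (cong₂ _+_ (deg-star p) (deg-star q))) (trans (sym (nb-++ _ A B v)) d))))
  go : (∃ λ K′ → K ≡ ups v K′) → (∃ λ M′ → M ≡ ups v M′) → Degree2 v A B
  go (K′ , refl) (M′ , refl) = record { x = x ; y = y ; A₀ = K′ ; B₀ = M′ ; permA = p ; permB = q }

degree1 : ∀ (v : Fin (suc n)) L → deg L v ≡ 1 → ∃₂ λ x K → L ↭ (v , punchIn v x) ∷ ups v K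
degree1 v L d with nb>0 (λ _ → 1) L v (≤-reflexive (sym d))
... | u , _ , e with view v u | ∈⇒↭ e
-- A loop at `v` would already contribute 2.
...   | pivot | K , p = contradiction (trans (sym (trans (nb-↭ _ v p) (cong (λ k → k + k + deg K v) (at-same v 1)))) d) λ ()
...   | other x | K , p with deg0⇒ups v K (suc-injective (trans (sym (deg-star p)) d))
...     | K′ , refl = x , K′ , p

degree3 : ∀ {A B : Edges (2 + n)} → Tree A → Tree B → ∀ v → deg (A ++ B) v ≡ 3 → Degree3 v A B ⊎ Degree3 v B A
degree3 {A = A} {B} s t v d with star s v | star t v
... | x , K , p | y , M , q = go (deg K v) (deg M v) refl refl d1
  where
  d1 : deg K v + deg M v ≡ 1
  d1 = suc-injective (suc-injective (trans (cong suc (sym (+-suc (deg K v) _)))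
    (trans (sym (cong₂ _+_ (deg-star p) (deg-star q))) (trans (sym (nb-++ _ A B v)) d))))
  build : ∀ {A B} {x y K M} → A ↭ (v , punchIn v x) ∷ K → B ↭
    (v , punchIn v y) ∷ M → deg K v ≡ 1 → deg M v ≡ 0 → Degree3 v A B
  build {K = K} {M} p q k m with degree1 v K k | deg0⇒ups v M m
  ... | x′ , K′ , r | M′ , refl = record { permA = ↭-trans p (↭-prep _ r) ; permB = q }
  go : ∀ k m → deg K v ≡ k → deg M v ≡ m → k + m ≡ 1 → Degree3 v A B ⊎ Degree3 v B A
  go 0 1 k m _ = inj₂ (build q p m k)
  go 1 0 k m _ = inj₁ (build p q k m)

move-leaf : ∀ {v x y : Fin n} {L} → deg L v ≡ 0 → x ≢ v → y ≢ v → Tree ((v , x) ∷ L) → Tree ((v , y) ∷ L)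
move-leaf {n = suc n} {v} {x} {y} {L} d x≢v y≢v t with view v x | view v y | deg0⇒ups v L d
... | pivot | _ | _ = contradiction refl x≢v
... | other _ | pivot | _ = contradiction refl y≢v
... | other x | other y | K , refl = add-leaf v (remove-leaf v t)

-- Two degree 2 vertices v and u with a common neighbour w: once v is gone, the edge uw is replaced by uy
-- for the other neighbour y of v. Putting everything back adds one to both degrees of w.
insert-merged : ∀ (v : Fin (suc n)) {u w y : Fin n} {C D X Y} →
  deg (((u , w) ∷ C) ++ D) u ≡ 2 → w ≢ u → y ≢ u →
  (v , punchIn v w) ∷ (v , punchIn v y) ∷ ups v (((u , w) ∷ C) ++ D) ↭ X ++ Y →
  Balanced ((u , y) ∷ C) D → Balanced X Y
insert-merged v {u} {w} {y} {C} {D} {X} {Y} du w≢u y≢u p b with locate b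
... | S , E , s , t , q , c =
  balanced (add-leaf v {x = y} (move-leaf dS y≢u w≢u s)) (add-leaf v {x = w} t) perm by
  where
  open ≡-Reasoning
  A′ = (v , punchIn v y) ∷ ups v ((u , w) ∷ S)
  B′ = (v , punchIn v w) ∷ ups v E

  dSE : deg S u + deg E u ≡ 1
  dSE = suc-injective (begin
    1 + (deg S u + deg E u) ≡⟨ cong suc (nb-++ _ S E u) ⟨
    1 + deg (S ++ E) u ≡⟨ cong suc (nb-↭ _ u q) ⟩
    1 + deg (C ++ D) u ≡⟨ nb-∷-end _ (C ++ D) w≢u ⟨
    deg (((u , w) ∷ C) ++ D) u ≡⟨ du ⟩
    2 ∎)

  -- Only one edge at `u` is left for `S` and `E` together, and the tree `E` needs it. So `u` is a
  -- leaf of the first tree, and its edge can be turned back from `y` to `w`.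
  dS : deg S u ≡ 0
  dS = n≤0⇒n≡0 (+-cancelʳ-≤ (deg E u) _ 0 (≤-trans (≤-reflexive dSE) (conn⇒deg>0 (proj₁ t) (w≢u ∘ sym))))

  perm : A′ ++ B′ ↭ X ++ Y
  perm = ↭-trans (Perm.↭-shift (unordered _) A′ (ups v E))
    (↭-trans (↭-prep _ (↭-prep _ (↭-prep _ (ups-++ v S E C D q))))
    (↭-trans (↭-reflexive (cong (λ L → _ ∷ _ ∷ _ ∷ L) (sym (map-++ (up v) C D)))) p))

  by : ∀ z → Close (deg A′ z) (deg B′ z)
  by z with view v z
  ... | pivot rewrite nb-leaf-pivot v (λ _ → 1) y ((u , w) ∷ S) | nb-leaf-pivot v (λ _ → 1) w E = s≤s z≤n , s≤s z≤n
  ... | other z rewrite deg-leaf v y ((u , w) ∷ S) z | deg-leaf v w E z =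
    subst (λ d → Close d (at w z 1 + deg E z)) (arith (at u z 1) (at y z 1) (at w z 1) (deg S z))
      (close-suc (at w z 1) (c z))
    where
    arith : ∀ u y w d → w + (u + y + d) ≡ y + (u + w + d)
    arith = solve-∀

above8 : ℕ → ℕ
above8 d = if 8 <ᵇ d then 1 else 0

above8-spec : ∀ d → (d ≤ 8 × above8 d ≡ 0) ⊎ (9 ≤ d × above8 d ≡ 1)
above8-spec d with 8 <ᵇ d | <ᵇ-reflects-< 8 d
... | true | ofʸ lt = inj₂ (lt , refl)
... | false | ofⁿ ge = inj₁ (≮⇒≥ ge , refl)

leaf-end : ∀ (v : Fin (suc n)) {w x L} → (v , punchIn v w) ∈ (v , punchIn v x) ∷ ups v L → w ≡ x
leaf-end v {w} {x} (here e) with ≐-cases e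
... | inj₁ (_ , eq) = punchIn-injective v w x eq
... | inj₂ (eq , _) = contradiction (sym eq) (punchInᵢ≢i v x)
leaf-end v (there e) with ups-∈⁻ v e
... | c , _ , _ , eq , _ = contradiction (sym eq) (punchInᵢ≢i v c)

-- The induction step for two trees

module Step {n} (balance : ∀ {A B : Edges (suc n)} → Tree A → Tree B → Balanced A B)
            {A B : Edges (2 + n)} (treeA : Tree A) (treeB : Tree B) where

  G = A ++ B

  big : Fin (2 + n) → ℕ
  big = above8 ∘ deg G

  -- What a vertex of the given degree takes from each big neighbour. Two big neighbours just make
  -- up for its negative charge: 4 + 2 * 2 = 8 and 6 + 2 * 1 = 8.
  weight : ℕ → ℕ
  weight 2 = 2
  weight 3 = 1
  weight _ = 0

  two : ℕ → ℕ
  two 2 = 1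
  two _ = 0

  small-one : ∀ u w → big u + big w < 2 → deg G u ≤ 8 ⊎ deg G w ≤ 8
  small-one u w lt with above8-spec (deg G u) | above8-spec (deg G w)
  ... | inj₁ (du , _) | _ = inj₁ du
  ... | inj₂ _ | inj₁ (dw , _) = inj₂ dw
  ... | inj₂ (_ , bu) | inj₂ (_ , bw) = contradiction lt (<-irrefl (cong₂ _+_ bu bw))

  case-leaf-leaf : ∀ {v} (D : Degree2 v A B) → let open Degree2 D in
    deg G (punchIn v x) ≤ 8 ⊎ deg G (punchIn v y) ≤ 8 ⊎ x ≡ y → Balanced A B
  case-leaf-leaf {v} D h = go h
    where
    open Degree2 D
    A₁ = (v , punchIn v x) ∷ ups v A₀
    B₁ = (v , punchIn v y) ∷ ups v B₀
    p : G ↭ A₁ ++ B₁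
    p = ++⁺ permA permB
    rec : Balanced A₀ B₀
    rec = balance (remove-leaf v (tree-↭ permA treeA)) (remove-leaf v (tree-↭ permB treeB))
    go : deg G (punchIn v x) ≤ 8 ⊎ deg G (punchIn v y) ≤ 8 ⊎ x ≡ y → Balanced A B
    go (inj₁ dx) = balanced-↭ (↭-sym p) (insert-leaf-leaf v (inj₁ (subst (_≤ 8) (nb-↭ _ _ p) dx)) rec)
    go (inj₂ (inj₁ dy)) = balanced-↭ (↭-trans (++-comm B₁ A₁) (↭-sym p))
      (insert-leaf-leaf v (inj₁ (subst (_≤ 8) (nb-↭ _ _ (↭-trans p (++-comm A₁ B₁))) dy)) (balanced-sym rec))
    go (inj₂ (inj₂ x≡y)) = balanced-↭ (↭-sym p) (insert-leaf-leaf v (inj₂ x≡y) rec)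

  nb-degree2 : ∀ {v} (D : Degree2 v A B) f → let open Degree2 D in nb f G v ≡ f (punchIn v x) + f (punchIn v y)
  nb-degree2 {v} D f = let open Degree2 D in trans (nb-++ f A B v) (cong₂ _+_
    (trans (nb-↭ f v permA) (nb-leaf-pivot v f x A₀)) (trans (nb-↭ f v permB) (nb-leaf-pivot v f y B₀)))

  low2 : ∀ v → deg G v ≡ 2 → nb big G v < 2 → Balanced A B
  low2 v d lt = case-leaf-leaf D ([ inj₁ , inj₂ ∘ inj₁ ]′ (small-one _ _ (subst (_< 2) (nb-degree2 D big) lt)))
    where
    D = degree2 treeA treeB v d

  case-path-leaf : ∀ {v X Y} → Degree3 v X Y → Tree X → Tree Y → X ++ Y ↭ G → nb big G v < 2 → Balanced X Y
  case-path-leaf {v} {X} {Y} D s t q lt = balanced-↭ (↭-sym p) (insert-path-leaf v h rec)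
    where
    open Degree3 D
    X₁ = (v , punchIn v x) ∷ (v , punchIn v y) ∷ ups v A₀
    Y₁ = (v , punchIn v z) ∷ ups v B₀
    p : X ++ Y ↭ X₁ ++ Y₁
    p = ++⁺ permA permB
    q₁ : G ↭ X₁ ++ Y₁
    q₁ = ↭-trans (↭-sym q) p
    rec : Balanced ((x , y) ∷ A₀) B₀
    rec = balance (suppress v (tree-↭ permA s)) (remove-leaf v (tree-↭ permB t))
    three : nb big G v ≡ big (punchIn v x) + big (punchIn v y) + big (punchIn v z)
    three = trans (nb-↭ big v q₁) (trans (nb-++ big X₁ Y₁ v) (cong₂ _+_
      (trans (nb-∷-end big ((v , punchIn v y) ∷ ups v A₀) (punchInᵢ≢i v x))
        (cong (big (punchIn v x) +_) (nb-leaf-pivot v big y A₀)))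
      (nb-leaf-pivot v big z B₀)))
    lt₃ = subst (_< 2) three lt
    bx = big (punchIn v x)
    by = big (punchIn v y)
    bz = big (punchIn v z)
    transport : ∀ u → deg G u ≤ 8 → deg (X₁ ++ Y₁) u ≤ 8
    transport u = subst (_≤ 8) (nb-↭ _ u q₁)
    h : deg (X₁ ++ Y₁) (punchIn v z) ≤ 8 ⊎ deg (X₁ ++ Y₁) (punchIn v x) ≤ 8 × deg (X₁ ++ Y₁) (punchIn v y) ≤ 8
    -- With at most one big vertex among the three neighbours, `z` is small or both `x` and `y` are.
    h with small-one (punchIn v x) (punchIn v z) (≤-trans (s≤s (+-monoˡ-≤ bz (m≤m+n bx by))) lt₃)
         | small-one (punchIn v y) (punchIn v z) (≤-trans (s≤s (+-monoˡ-≤ bz (m≤n+m by bx))) lt₃)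
    ... | inj₂ dz | _ = inj₁ (transport _ dz)
    ... | inj₁ _ | inj₂ dz = inj₁ (transport _ dz)
    ... | inj₁ dx | inj₁ dy = inj₂ (transport _ dx , transport _ dy)

  low3 : ∀ v → deg G v ≡ 3 → nb big G v < 2 → Balanced A B
  low3 v d lt with degree3 treeA treeB v d
  ... | inj₁ D = case-path-leaf D treeA treeB ↭-refl lt
  ... | inj₂ D = balanced-sym (case-path-leaf D treeB treeA (++-comm B A) lt)

  -- Both trees still reach `u` after `v` is removed, which accounts for both edges at `u`. Hence
  -- `y ≢ u`, and `u` is a leaf in each remaining tree, so its edge to `w` can be redirected to `y`
  -- before the recursive call.
  case-merged : ∀ {v u w y X Y X₀ Y₀} → Tree X → Tree Y → X ++ Y ↭ G →
    X ↭ (v , punchIn v w) ∷ ups v X₀ → Y ↭ (v , punchIn v y) ∷ ups v Y₀ →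
    deg G (punchIn v u) ≡ 2 → u ≢ w → (punchIn v u , punchIn v w) ∈ G → Balanced X Y
  case-merged {v} {u} {w} {y} {X} {Y} {X₀} {Y₀} s t q pX pY du u≢w uw∈G with ∈-++⁻ _ (∈-resp-↭ r uw∈G)
    where
    r : G ↭ ((v , punchIn v w) ∷ ups v X₀) ++ ((v , punchIn v y) ∷ ups v Y₀)
    r = ↭-trans (↭-sym q) (++⁺ pX pY)
  ... | e = [ (λ e → finish s₀ t₀ ↭-refl (lower e)) , (λ e → finish t₀ s₀ (++-comm Y₀ X₀) (lower e)) ]′ e
    where
    s₀ = remove-leaf v (tree-↭ pX s)
    t₀ = remove-leaf v (tree-↭ pY t)

    lower : ∀ {z L} → (punchIn v u , punchIn v w) ∈ (v , z) ∷ ups v L → (u , w) ∈ L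
    lower (here e) with ≐-cases e
    ... | inj₁ (eq , _) = contradiction eq (punchInᵢ≢i v u)
    ... | inj₂ (_ , eq) = contradiction eq (punchInᵢ≢i v w)
    lower (there e) with ups-∈⁻ v e
    ... | c , d , e′ , eqc , eqd with punchIn-injective v u c eqc | punchIn-injective v w d eqd
    ...   | refl | refl = e′

    total : at y u 1 + (deg X₀ u + deg Y₀ u) ≡ 2
    total = begin
      at y u 1 + (deg X₀ u + deg Y₀ u)                    ≡⟨ arith (at y u 1) (deg X₀ u) (deg Y₀ u) ⟩
      (0 + deg X₀ u) + (at y u 1 + deg Y₀ u)              ≡⟨ cong (λ k → (k + deg X₀ u) + (at y u 1 + deg Y₀ u)) (at-diff 1 (u≢w ∘ sym)) ⟨
      (at w u 1 + deg X₀ u) + (at y u 1 + deg Y₀ u)       ≡⟨ cong₂ _+_ (deg-leaf v w X₀ u) (deg-leaf v y Y₀ u) ⟨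
      deg ((v , punchIn v w) ∷ ups v X₀) (punchIn v u) + deg ((v , punchIn v y) ∷ ups v Y₀) (punchIn v u)
                                                          ≡⟨ cong₂ _+_ (nb-↭ _ _ pX) (nb-↭ _ _ pY) ⟨
      deg X (punchIn v u) + deg Y (punchIn v u)           ≡⟨ nb-++ _ X Y _ ⟨
      deg (X ++ Y) (punchIn v u)                          ≡⟨ nb-↭ _ _ q ⟩
      deg G (punchIn v u)                                 ≡⟨ du ⟩
      2                                                   ∎
      where
      open ≡-Reasoning
      arith : ∀ a b c → a + (b + c) ≡ (0 + b) + (a + c)
      arith = solve-∀

    X₀≥1 : 1 ≤ deg X₀ u
    X₀≥1 = conn⇒deg>0 (proj₁ s₀) u≢w
    Y₀≥1 : 1 ≤ deg Y₀ u
    Y₀≥1 = conn⇒deg>0 (proj₁ t₀) u≢w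

    y≢u : y ≢ u
    y≢u refl = <-irrefl refl (≤-trans (s≤s (+-mono-≤ X₀≥1 Y₀≥1)) (≤-reflexive (trans (cong (_+
      (deg X₀ u + deg Y₀ u)) (sym (at-same u 1))) total)))

    deg-X₀Y₀ : deg X₀ u + deg Y₀ u ≡ 2
    deg-X₀Y₀ = trans (cong (_+ (deg X₀ u + deg Y₀ u)) (sym (at-diff 1 y≢u))) total

    finish : ∀ {P Q} → Tree P → Tree Q → P ++ Q ↭ X₀ ++ Y₀ → (u , w) ∈ P → Balanced X Y
    finish {P} {Q} s t q′ e with ∈⇒↭ e
    ... | C , p = insert-merged v {u} {w} {y} {C} {Q} dC (u≢w ∘ sym) y≢u perm
                    (balance (move-leaf dC0 (u≢w ∘ sym) y≢u (tree-↭ p s)) t)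
      where
      CQ : ((u , w) ∷ C) ++ Q ↭ X₀ ++ Y₀
      CQ = ↭-trans (++⁺ʳ Q (↭-sym p)) q′
      dC : deg (((u , w) ∷ C) ++ Q) u ≡ 2
      dC = trans (nb-↭ _ u CQ) (trans (nb-++ _ X₀ Y₀ u) deg-X₀Y₀)
      dC0 : deg C u ≡ 0
      dC0 = n≤0⇒n≡0 (+-cancelʳ-≤ 1 _ 0 (≤-pred (≤-trans (s≤s (+-monoʳ-≤ (deg C u) (conn⇒deg>0 (proj₁ t) u≢w)))
        (≤-reflexive (trans (cong (_+ deg Q u) (sym (nb-∷-end _ C (u≢w ∘ sym))))
          (trans (sym (nb-++ _ ((u , w) ∷ C) Q u)) dC))))))
      perm : (v , punchIn v w) ∷ (v , punchIn v y) ∷ ups v (((u , w) ∷ C) ++ Q) ↭ X ++ Y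
      perm = ↭-sym (↭-trans (++⁺ pX pY) (↭-prep _ (↭-trans (Perm.↭-shift (unordered _) (ups v X₀) _)
        (↭-prep _ (↭-trans (↭-reflexive (sym (map-++ (up v) X₀ Y₀))) (ups-↭ v (↭-sym CQ)))))))

  merged : ∀ {v u w} → deg G v ≡ 2 → deg G u ≡ 2 → v ≢ u → v ≢ w → u ≢ w → (v , w) ∈ G → (u , w) ∈ G → Balanced A B
  merged {v} {u} {w} dv du v≢u v≢w u≢w vw∈G uw∈G with view v u | view v w
  ... | pivot | _ = contradiction refl v≢u
  ... | other _ | pivot = contradiction refl v≢w
  ... | other u | other w with ∈-++⁻ A vw∈G
  ...   | inj₁ e = go (leaf-end v (∈-resp-↭ permA e))
    where
    open Degree2 (degree2 treeA treeB v dv)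
    go : w ≡ x → Balanced A B
    go refl = case-merged treeA treeB ↭-refl permA permB du (u≢w ∘ cong (punchIn v)) uw∈G
  ...   | inj₂ e = go (leaf-end v (∈-resp-↭ permB e))
    where
    open Degree2 (degree2 treeA treeB v dv)
    go : w ≡ y → Balanced A B
    go refl = balanced-sym (case-merged treeB treeA (++-comm B A) permB permA du (u≢w ∘ cong (punchIn v)) uw∈G)

  two-nonzero : ∀ d → 0 < two d → d ≡ 2
  two-nonzero 2 _ = refl

  -- Each tree contains exactly one of the two edges, so `w` gains one in both, however big it is.
  doubled : ∀ {v w K} → deg G v ≡ 2 → v ≢ w → G ↭ (v , w) ∷ (v , w) ∷ K → Balanced A B
  doubled {v} {w} {K} d v≢w p = case-leaf-leaf D (inj₂ (inj₂ (punchIn-injective v x y (trans (meets x y le) (sym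
    (meets y x (subst (2 ≤_) (+-comm (f (punchIn v x)) _) le)))))))
    where
    D = degree2 treeA treeB v d
    open Degree2 D
    f : Fin (2 + n) → ℕ
    f u = at u w 1
    le : 2 ≤ f (punchIn v x) + f (punchIn v y)
    le = ≤-trans (≤-trans (≤-reflexive (sym (cong₂ _+_ (at-same w 1) (at-same w 1))))
      (≤-trans (+-monoʳ-≤ (f w) (m≤m+n (f w) (nb f K v))) (≤-reflexive (sym (trans (nb-∷-end f ((v , w) ∷ K)
        (v≢w ∘ sym)) (cong (f w +_) (nb-∷-end f K (v≢w ∘ sym))))))))
      (≤-reflexive (trans (sym (nb-↭ f v p)) (nb-degree2 D f)))
    at-≤1 : ∀ u → f u ≤ 1
    at-≤1 u with does (u ≟ w)
    ... | true = s≤s z≤n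
    ... | false = z≤n
    meets : ∀ x y → 2 ≤ f (punchIn v x) + f (punchIn v y) → punchIn v x ≡ w
    meets x y le with punchIn v x ≟ w
    ... | yes eq = eq
    ... | no _ = contradiction le (<⇒≱ (s≤s (at-≤1 (punchIn v y))))

  -- The neighbours are counted with multiplicity. After one edge to a vertex `v` of degree 2 is
  -- taken out, a second one remains, possibly to `v` again; this is where the parallel case splits
  -- off.
  high : ∀ w → 9 ≤ deg G w → 2 ≤ nb (two ∘ deg G) G w → Balanced A B
  high w d le with nb>0 (two ∘ deg G) G w (≤-trans (n≤1+n 1) le)
  ... | v , two-v , e with two-nonzero _ two-v | ∈⇒↭ e
  ...   | dv | K , p with nb>0 (two ∘ deg G) K w (≤-pred (≤-trans le (≤-reflexive
                          (trans (nb-↭ _ w p) (trans (nb-∷-end _ K v≢w) (cong (λ d → two d + nb (two ∘ deg G) K w) dv))))))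
    where
    v≢w : v ≢ w
    v≢w refl = contradiction (subst (9 ≤_) dv d) λ { (s≤s (s≤s ())) }
  ...     | u , two-u , e′ with two-nonzero _ two-u | v ≟ u
  ...       | du | yes refl = let K′ , p′ = ∈⇒↭ e′ in
    doubled dv (λ { refl → contradiction (subst (9 ≤_) dv d) λ { (s≤s (s≤s ())) } }) (↭-trans p (prep flip (↭-trans p′ (prep flip ↭-refl))))
  ...       | du | no v≢u = merged dv du v≢u
    (λ { refl → contradiction (subst (9 ≤_) dv d) λ { (s≤s (s≤s ())) } })
    (λ { refl → contradiction (subst (9 ≤_) du d) λ { (s≤s (s≤s ())) } })
    (∈-≐ flip e) (∈-≐ flip (∈-resp-↭ (↭-sym p) (there e′)))

  low : ∀ d w → deg G w ≡ d → 2 ≤ d → 2 * d + weight d * nb big G w < 8 → Balanced A B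
  low 0 w _ ()
  low 1 w _ (s≤s ())
  low 2 w d _ lt = low2 w d (*-cancelˡ-< 2 _ 2 (+-cancelˡ-< 4 _ 4 lt))
  low 3 w d _ lt = low3 w d (+-cancelˡ-< 6 _ 2 (subst (λ k → 6 + k < 8) (+-identityʳ _) lt))
  low (suc (suc (suc (suc d)))) w _ _ lt =
    contradiction (≤-trans (≤-trans (*-monoʳ-≤ 2 (s≤s (s≤s (s≤s (s≤s (z≤n {d})))))) (m≤m+n _ _)) (≤-reflexive refl)) (<⇒≱ lt)

  weight≤ : ∀ d → weight d ≤ 1 + two d
  weight≤ 0 = z≤n
  weight≤ 1 = z≤n
  weight≤ 2 = ≤-refl
  weight≤ 3 = ≤-refl
  weight≤ (suc (suc (suc (suc d)))) = z≤n

  result : Balanced A B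
  result with deficient treeA treeB (weight ∘ deg G) big z<s
  ... | w , lt with above8-spec (deg G w)
  ...   | inj₁ (_ , eq) = low _ w refl d≥2 (subst (2 * deg G w + weight (deg G w) * nb big G w <_) (cong
    (λ b → 8 + b * nb (weight ∘ deg G) G w) eq) lt)
    where
    d≥2 : 2 ≤ deg G w
    d≥2 = subst (2 ≤_) (sym (nb-++ _ A B w)) (+-mono-≤ (conn⇒deg>0 (proj₁ treeA) (punchInᵢ≢i w zero ∘ sym))
      (conn⇒deg>0 (proj₁ treeB) (punchInᵢ≢i w zero ∘ sym)))
  ...   | inj₂ (d≥9 , eq) = high w d≥9 (≮⇒≥ few)
    where
    few : ¬ nb (two ∘ deg G) G w < 2
    few (s≤s nb≤1) = <⇒≱ d<9 d≥9
      where
      open ≤-Reasoning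
      -- With at most one edge to a vertex of degree 2, deficiency gives 2 d < 8 + d + 1. This
      -- inequality determines the threshold 9 for big vertices.
      d<9 : deg G w < 9
      d<9 = +-cancelˡ-< (deg G w) _ _ (begin-strict
        deg G w + deg G w                      ≡⟨ cong (deg G w +_) (+-identityʳ _) ⟨
        2 * deg G w                            ≤⟨ m≤m+n _ _ ⟩
        2 * deg G w + weight (deg G w) * nb big G w <⟨ lt ⟩
        8 + big w * nb (weight ∘ deg G) G w    ≡⟨ cong (λ b → 8 + b * nb (weight ∘ deg G) G w) eq ⟩
        8 + 1 * nb (weight ∘ deg G) G w        ≡⟨ cong (8 +_) (*-identityˡ _) ⟩
        8 + nb (weight ∘ deg G) G w            ≤⟨ +-monoʳ-≤ 8 (nb-≤ (weight≤ ∘ deg G) G w) ⟩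
        8 + (deg G w + nb (two ∘ deg G) G w)   ≤⟨ +-monoʳ-≤ 8 (+-monoʳ-≤ (deg G w) nb≤1) ⟩
        8 + (deg G w + 1)                      ≡⟨ arith (deg G w) ⟩
        deg G w + 9                            ∎)
        where
        arith : ∀ d → 8 + (d + 1) ≡ d + 9
        arith = solve-∀

balance : ∀ n {A B : Edges (suc n)} → Tree A → Tree B → Balanced A B
balance zero {[]} {[]} s t = balanced s t ↭-refl λ _ → z≤n , z≤n
balance zero {_ ∷ _} (_ , ()) _
balance zero {[]} {_ ∷ _} _ (_ , ())
balance (suc n) = Step.result (balance n)

-- Averaging schedules

-- What balancing the trees `i` and `j` looks like at a single vertex: `x` and `y` give its degree
-- in each tree before and after.
record Averaging (i j : ℕ) (x y : ℕ → ℕ) : Set where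
  constructor averaging
  field
    total : y i + y j ≡ x i + x j
    close : Close (y i) (y j)
    fixed : ∀ l → l ≢ i → l ≢ j → y l ≡ x l

-- The schedule is an index of the type, so that all vertices follow the same one although their
-- degree sequences differ.
data Moves : List (ℕ × ℕ) → (ℕ → ℕ) → (ℕ → ℕ) → Set where
  done : ∀ {x} → Moves [] x x
  move : ∀ {i j ps x y z} → Averaging i j x y → Moves ps y z → Moves ((i , j) ∷ ps) x z

moves-++ : ∀ ps {qs x z} → Moves (ps ++ qs) x z → ∃ λ y → Moves ps x y × Moves qs y z
moves-++ [] m = _ , done , m
moves-++ (_ ∷ ps) (move s m) = let y , m₁ , m₂ = moves-++ ps m in y , move s m₁ , m₂

Valid : ℕ → ℕ × ℕ → Set
Valid k (i , j) = i < j × j < k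

sweep : ℕ → ℕ → ℕ → List (ℕ × ℕ)
sweep o p zero = []
sweep o p (suc r) = (o , p) ∷ sweep (suc o) (suc p) r

sweep-valid : ∀ o p r {k} → o < p → p + r ≤ k → All (Valid k) (sweep o p r)
sweep-valid o p zero _ _ = []
sweep-valid o p (suc r) o<p le = (o<p , ≤-trans (≤-trans (s≤s (m≤m+n p r)) (≤-reflexive (sym (+-suc p r)))) le) ∷
  sweep-valid (suc o) (suc p) r (s<s o<p) (≤-trans (≤-reflexive (sym (+-suc p r))) le)

sweep-fixed : ∀ o p r {x y} → Moves (sweep o p r) x y → ∀ l → l < o ⊎ (o + r ≤ l × l < p) ⊎ p + r ≤ l → o < p → y l ≡ x l
sweep-fixed o p zero done l _ _ = refl
sweep-fixed o p (suc r) (move s m) l h o<p =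
  trans (sweep-fixed (suc o) (suc p) r m l (shift-range h) (s<s o<p)) (Averaging.fixed s l (l≢o h) (l≢p h))
  where
  shift-range : l < o ⊎ (o + suc r ≤ l × l < p) ⊎ p + suc r ≤ l → l < suc o ⊎ (suc o + r ≤ l × l < suc p) ⊎ suc p + r ≤ l
  shift-range (inj₁ lt) = inj₁ (m<n⇒m<1+n lt)
  shift-range (inj₂ (inj₁ (le , lt))) = inj₂ (inj₁ (subst (_≤ l) (+-suc o r) le , m<n⇒m<1+n lt))
  shift-range (inj₂ (inj₂ le)) = inj₂ (inj₂ (subst (_≤ l) (+-suc p r) le))
  l≢o : l < o ⊎ (o + suc r ≤ l × l < p) ⊎ p + suc r ≤ l → l ≢ o
  l≢o (inj₁ lt) = <⇒≢ lt
  l≢o (inj₂ (inj₁ (le , _))) refl = m+1+n≰m o le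
  l≢o (inj₂ (inj₂ le)) refl = m+1+n≰m p (≤-trans le (<⇒≤ o<p))
  l≢p : l < o ⊎ (o + suc r ≤ l × l < p) ⊎ p + suc r ≤ l → l ≢ p
  l≢p (inj₁ lt) = <⇒≢ (<-trans lt o<p)
  l≢p (inj₂ (inj₁ (_ , lt))) = <⇒≢ lt
  l≢p (inj₂ (inj₂ le)) refl = m+1+n≰m p le

-- Up to an error of 4, `z` is the mean of `a` and `b`; everything is doubled to avoid fractions.
HalfSum : ℕ → ℕ → ℕ → Set
HalfSum z a b = 2 * z ≤ a + b + 8 × a + b ≤ 2 * z + 8

halfSum : ∀ {y y′ a b} → y + y′ ≡ a + b → Close y y′ → HalfSum y a b × HalfSum y′ a b
halfSum {y} {y′} {a} {b} eq (l , r) rewrite sym eq =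
  (≤-trans (≤-reflexive (cong (y +_) (+-identityʳ y))) (≤-trans (+-monoʳ-≤ y l) (≤-reflexive (sym (+-assoc y y′ 8)))) ,
   ≤-trans (+-monoʳ-≤ y r) (≤-reflexive (arith₁ y))) ,
  (≤-trans (≤-reflexive (cong (y′ +_) (+-identityʳ y′))) (≤-trans (+-monoʳ-≤ y′ r) (≤-reflexive (arith₂ y y′))) ,
   ≤-trans (+-monoˡ-≤ y′ l) (≤-reflexive (arith₃ y′)))
  where
  arith₁ : ∀ y → y + (y + 8) ≡ 2 * y + 8
  arith₁ = solve-∀
  arith₂ : ∀ y z → z + (y + 8) ≡ y + z + 8
  arith₂ = solve-∀
  arith₃ : ∀ z → z + 8 + z ≡ 2 * z + 8
  arith₃ = solve-∀

-- The condition `o + r ≤ p` makes the pairs disjoint, so every step still sees the initial values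
-- of its two entries and no later step alters its outcome.
sweep-halves : ∀ o p r {x y} → o + r ≤ p → Moves (sweep o p r) x y → ∀ i → i < r →
  HalfSum (y (o + i)) (x (o + i)) (x (p + i)) × HalfSum (y (p + i)) (x (o + i)) (x (p + i))
sweep-halves o p (suc r) {x} {y} le (move {y = x₁} s m) zero _
  rewrite +-identityʳ o | +-identityʳ p
        | sweep-fixed (suc o) (suc p) r m o (inj₁ ≤-refl) (s<s (<-≤-trans (m<m+n o z<s) le))
        | sweep-fixed (suc o) (suc p) r m p (inj₂ (inj₁ (subst (_≤ p) (+-suc o r) le , ≤-refl)))
          (s<s (<-≤-trans (m<m+n o z<s) le))
  = halfSum {a = x o} (Averaging.total s) (Averaging.close s)
sweep-halves o p (suc r) {x} {y} le (move {y = x₁} s m) (suc i) i<r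
  rewrite +-suc o i | +-suc p i
        | sym (Averaging.fixed s (suc o + i) (m+1+n≢m o ∘ trans (+-suc o i))
          (<⇒≢ (≤-trans (≤-trans (s≤s (≤-reflexive (sym (+-suc o i)))) (+-monoʳ-< o i<r)) le)))
        | sym (Averaging.fixed s (suc p + i) (λ eq → <⇒≱ (<-≤-trans (m<m+n o z<s) le) (≤-trans (m≤n⇒m≤1+n
          (m≤m+n p i)) (≤-reflexive eq))) (m+1+n≢m p ∘ trans (+-suc p i)))
  = sweep-halves (suc o) (suc p) r (m≤n⇒m≤1+n (subst (_≤ p) (+-suc o r) le)) m i (s<s⁻¹ i<r)

-- The butterfly network on a block of 2^t positions

butterfly : ℕ → ℕ → List (ℕ × ℕ)
butterfly zero o = []
butterfly (suc t) o = butterfly t o ++ butterfly t (o + 2 ^ t) ++ sweep o (o + 2 ^ t) (2 ^ t)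

2^>0 : ∀ t → 0 < 2 ^ t
2^>0 t = m^n>0 2 t

o<o+2^ : ∀ o t → o < o + 2 ^ t
o<o+2^ o t = m<m+n o (2^>0 t)

o+2^suc : ∀ o t → o + 2 ^ t + 2 ^ t ≡ o + 2 ^ suc t
o+2^suc o t = trans (+-assoc o _ _) (cong (λ k → o + (2 ^ t + k)) (sym (+-identityʳ _)))

butterfly-valid : ∀ t o {k} → o + 2 ^ t ≤ k → All (Valid k) (butterfly t o)
butterfly-valid zero o _ = []
butterfly-valid (suc t) o {k} le =
  All.++⁺ (butterfly-valid t o (≤-trans (m≤m+n _ _) le′)) (All.++⁺ (butterfly-valid t (o + 2 ^ t) le′)
    (sweep-valid o (o + 2 ^ t) (2 ^ t) (o<o+2^ o t) le′))
  where
  le′ : o + 2 ^ t + 2 ^ t ≤ k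
  le′ = subst (_≤ k) (sym (o+2^suc o t)) le

butterfly-fixed : ∀ t o {x y} → Moves (butterfly t o) x y → ∀ l → l < o ⊎ o + 2 ^ t ≤ l → y l ≡ x l
butterfly-fixed zero o done l _ = refl
butterfly-fixed (suc t) o m l h with moves-++ (butterfly t o) m
... | x₁ , m₁ , m′ with moves-++ (butterfly t (o + 2 ^ t)) m′
...   | x₂ , m₂ , m₃ =
  trans (sweep-fixed o (o + 2 ^ t) (2 ^ t) m₃ l ([ inj₁ , inj₂ ∘ inj₂ ∘ subst (_≤ l) (sym (o+2^suc o t)) ]′ h) (o<o+2^ o t))
  (trans (butterfly-fixed t (o + 2 ^ t) m₂ l ([ (λ lt → inj₁ (≤-trans lt (m≤m+n o _))) , (λ le → inj₂ (subst
    (_≤ l) (sym (o+2^suc o t)) le)) ]′ h))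
  (butterfly-fixed t o m₁ l ([ inj₁ , (λ le → inj₂ (≤-trans (m≤m+n _ (2 ^ t)) (subst (_≤ l) (sym (o+2^suc o t)) le))) ]′ h)))

-- Both estimates below rest on this form of the recursion: an output is a half sum of two outputs,
-- with a common index `j`, of the smaller networks.
butterfly-halves : ∀ t o {x z} → Moves (butterfly (suc t) o) x z → ∃₂ λ x₁ x₂ →
  Moves (butterfly t o) x x₁ × Moves (butterfly t (o + 2 ^ t)) x₁ x₂ ×
  ∀ i → i < 2 ^ suc t → ∃ λ j → j < 2 ^ t × HalfSum (z (o + i)) (x₁ (o + j)) (x₂ (o + 2 ^ t + j))
butterfly-halves t o {x} {z} m with moves-++ (butterfly t o) m
... | x₁ , m₁ , m′ with moves-++ (butterfly t (o + 2 ^ t)) m′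
...   | x₂ , m₂ , m₃ = x₁ , x₂ , m₁ , m₂ , by
  where
  N = 2 ^ t
  halves : ∀ j → j < N → HalfSum (z (o + j)) (x₁ (o + j)) (x₂ (o + N + j)) × HalfSum (z (o + N + j)) (x₁ (o + j))
    (x₂ (o + N + j))
  halves j j<N = subst (λ a → HalfSum (z (o + j)) a (x₂ (o + N + j)) × HalfSum (z (o + N + j)) a (x₂ (o + N + j)))
    (butterfly-fixed t (o + N) m₂ (o + j) (inj₁ (+-monoʳ-< o j<N)))
    (sweep-halves o (o + N) N ≤-refl m₃ j j<N)
  by : ∀ i → i < 2 ^ suc t → ∃ λ j → j < N × HalfSum (z (o + i)) (x₁ (o + j)) (x₂ (o + N + j))
  by i lt with i <? N
  ... | yes i<N = i , i<N , proj₁ (halves i i<N)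
  ... | no i≮N = i ∸ N , j<N , subst (λ a → HalfSum (z a) (x₁ (o + (i ∸ N))) (x₂ (o + N + (i ∸ N))))
      (trans (+-assoc o N _) (cong (o +_) (m+[n∸m]≡n (≮⇒≥ i≮N)))) (proj₂ (halves _ j<N))
    where
    j<N : i ∸ N < N
    j<N = +-cancelˡ-< N _ _ (≤-trans (≤-reflexive (cong suc (m+[n∸m]≡n (≮⇒≥ i≮N)))) (≤-trans lt (≤-reflexive (cong
      (N +_) (+-identityʳ N)))))

half-≤ : ∀ {a b} → 2 * a ≤ 2 * b + 1 → a ≤ b
half-≤ {a} {b} le with a ≤? b
... | yes a≤b = a≤b
... | no a≰b = contradiction (≤-trans (*-monoʳ-≤ 2 (≰⇒> a≰b)) le) (<⇒≱ (≤-reflexive (arith b)))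
  where
  arith : ∀ b → 1 + (2 * b + 1) ≡ 2 * suc b
  arith = solve-∀

-- Averaging an entry of one half with an entry of the other averages the two spreads. The error of
-- 4 in each of the two compared outputs adds 8 per level.
butterfly-spread : ∀ t o {x y} → Moves (butterfly t o) x y → ∀ i j → i < 2 ^ t → j < 2 ^ t → y (o + i) ≤ y (o + j) + 8 * t
butterfly-spread zero o done zero zero _ _ = m≤m+n _ 0
butterfly-spread zero o done (suc _) _ (s≤s ()) _
butterfly-spread zero o done _ (suc _) _ (s≤s ())
butterfly-spread (suc t) o {x} {y} m i j lti ltj with butterfly-halves t o m
... | x₁ , x₂ , m₁ , m₂ , by with by i lti | by j ltj
...   | i′ , lti′ , hi , _ | j′ , ltj′ , _ , hj = *-cancelˡ-≤ 2 (begin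
  2 * y (o + i)                                         ≤⟨ hi ⟩
  x₁ (o + i′) + x₂ (o + 2 ^ t + i′) + 8                 ≤⟨ +-monoˡ-≤ 8 (+-mono-≤ (butterfly-spread t o m₁ i′ j′ lti′ ltj′) (butterfly-spread t (o + 2 ^ t) m₂ i′ j′ lti′ ltj′)) ⟩
  x₁ (o + j′) + 8 * t + (x₂ (o + 2 ^ t + j′) + 8 * t) + 8 ≡⟨ arith₁ (x₁ (o + j′)) (x₂ (o + 2 ^ t + j′)) t ⟩
  x₁ (o + j′) + x₂ (o + 2 ^ t + j′) + (16 * t + 8)      ≤⟨ +-monoˡ-≤ _ hj ⟩
  2 * y (o + j) + 8 + (16 * t + 8)                      ≡⟨ arith₂ (y (o + j)) t ⟩
  2 * (y (o + j) + 8 * suc t)                           ∎)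
  where
  open ≤-Reasoning
  arith₁ : ∀ a b t → a + 8 * t + (b + 8 * t) + 8 ≡ a + b + (16 * t + 8)
  arith₁ = solve-∀
  arith₂ : ∀ y t → 2 * y + 8 + (16 * t + 8) ≡ 2 * (y + 8 * suc t)
  arith₂ = solve-∀

-- A mean stays between its terms, so each level widens the interval only by the error 4 on either
-- side. This bound serves the entries that a round leaves without a partner outside the block.
butterfly-hull : ∀ t o {x y lo hi} → Moves (butterfly t o) x y → (∀ i → i < 2 ^ t → lo ≤ x (o + i) × x (o + i) ≤ hi) →
  ∀ i → i < 2 ^ t → lo ≤ y (o + i) + 4 * t × y (o + i) ≤ hi + 4 * t
butterfly-hull zero o done h i lt = let l , r = h i lt in ≤-trans l (m≤m+n _ 0) , ≤-trans r (m≤m+n _ 0)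
butterfly-hull (suc t) o {x} {y} {lo} {hi} m h i lt with butterfly-halves t o m
... | x₁ , x₂ , m₁ , m₂ , by with by i lt
...   | j , j<N , u , l with butterfly-hull t o m₁ (λ j lt → h j (≤-trans lt (m≤m+n _ _))) j j<N
                           | butterfly-hull t (o + 2 ^ t) m₂ upper j j<N
  where
  upper : ∀ j → j < 2 ^ t → lo ≤ x₁ (o + 2 ^ t + j) × x₁ (o + 2 ^ t + j) ≤ hi
  upper j lt rewrite butterfly-fixed t o m₁ (o + 2 ^ t + j) (inj₂ (m≤m+n _ j)) | +-assoc o (2 ^ t) j =
    h (2 ^ t + j) (+-monoʳ-< (2 ^ t) (≤-trans lt (≤-reflexive (sym (+-identityʳ _)))))
...     | l₁ , u₁ | l₂ , u₂ = *-cancelˡ-≤ 2 (begin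
  2 * lo                                                         ≡⟨ cong (lo +_) (+-identityʳ lo) ⟩
  lo + lo                                                        ≤⟨ +-mono-≤ l₁ l₂ ⟩
  x₁ (o + j) + 4 * t + (x₂ (o + 2 ^ t + j) + 4 * t)              ≡⟨ arith₁ (x₁ (o + j)) (x₂ (o + 2 ^ t + j)) t ⟩
  x₁ (o + j) + x₂ (o + 2 ^ t + j) + 8 * t                        ≤⟨ +-monoˡ-≤ (8 * t) l ⟩
  2 * y (o + i) + 8 + 8 * t                                      ≡⟨ arith₂ (y (o + i)) t ⟩
  2 * (y (o + i) + 4 * suc t)                                    ∎) , *-cancelˡ-≤ 2 (begin
  2 * y (o + i)                                                  ≤⟨ u ⟩
  x₁ (o + j) + x₂ (o + 2 ^ t + j) + 8                            ≤⟨ +-monoˡ-≤ 8 (+-mono-≤ u₁ u₂) ⟩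
  hi + 4 * t + (hi + 4 * t) + 8                                  ≡⟨ arith₃ hi t ⟩
  2 * (hi + 4 * suc t)                                           ∎)
  where
  open ≤-Reasoning
  arith₁ : ∀ a b t → a + 4 * t + (b + 4 * t) ≡ a + b + 8 * t
  arith₁ = solve-∀
  arith₂ : ∀ y t → 2 * y + 8 + 8 * t ≡ 2 * (y + 4 * suc t)
  arith₂ = solve-∀
  arith₃ : ∀ h t → h + 4 * t + (h + 4 * t) + 8 ≡ 2 * (h + 4 * suc t)
  arith₃ = solve-∀

minimum : ∀ (x : ℕ → ℕ) k → ∃ λ a → a < suc k × ∀ i → i < suc k → x a ≤ x i
minimum x zero = 0 , z<s , λ { zero _ → ≤-refl ; (suc _) (s≤s ()) }
minimum x (suc k) with minimum x k
... | a , lt , min with ≤-total (x a) (x (suc k))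
...   | inj₁ le = a , m<n⇒m<1+n lt , λ i i<k → case m≤n⇒m<n∨m≡n (s≤s⁻¹ i<k) of λ
        { (inj₁ i<1+k) → min i i<1+k ; (inj₂ refl) → le }
...   | inj₂ ge = suc k , ≤-refl , λ i i<k → case m≤n⇒m<n∨m≡n (s≤s⁻¹ i<k) of λ
        { (inj₁ i<1+k) → ≤-trans ge (min i i<1+k) ; (inj₂ refl) → ≤-refl }

minimum′ : ∀ (x : ℕ → ℕ) {k} → 0 < k → ∃ λ a → a < k × ∀ i → i < k → x a ≤ x i
minimum′ x {suc k} _ = minimum x k

Spread : ℕ → ℕ → (ℕ → ℕ) → Set
Spread k W x = ∃ λ lo → ∀ i → i < k → lo ≤ x i × x i ≤ lo + W

-- Repeated rounds when k is not a power of two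

module Rounds (t r : ℕ) (r<N : r < 2 ^ t) where

  private
    N = 2 ^ t
    k = N + r

  round : List (ℕ × ℕ)
  round = butterfly t 0 ++ sweep 0 N r

  rounds : ℕ → List (ℕ × ℕ)
  rounds zero = []
  rounds (suc s) = round ++ rounds s

  rounds-valid : ∀ s → All (Valid k) (rounds s)
  rounds-valid zero = []
  rounds-valid (suc s) = All.++⁺ (All.++⁺ (butterfly-valid t 0 (m≤m+n _ r)) (sweep-valid 0 N r (2^>0 t) ≤-refl))
    (rounds-valid s)

  -- Up to errors, twice every entry is a number in [pa, pa + 8 t] plus a number in [lo, lo + W],
  -- where `pa` is the least block entry after the butterfly. For a paired entry these are the two
  -- averaged numbers. For an unpaired one both are the entry itself, which lies in the first
  -- interval and, by `butterfly-hull`, within 4 t of the second. Hence the choice of `c` as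
  -- `pa + lo`.
  round-hull : ∀ {x y W} → Moves round x y → Spread k W x → ∃ λ c → ∀ i → i < k →
    c ≤ 2 * y i + (4 * t + 8) × 2 * y i ≤ c + (W + 12 * t + 8)
  round-hull {x} {z} {W} m (lo , h) with moves-++ (butterfly t 0) m
  ... | y , m₁ , m₂ with minimum′ y (2^>0 t)
  ...   | a , a<N , min = y a + lo , by
    where
    open ≤-Reasoning
    pa = y a
    block : ∀ i → i < N → pa ≤ y i × y i ≤ pa + 8 * t × lo ≤ y i + 4 * t × y i ≤ lo + W + 4 * t
    block i lt = min i lt , butterfly-spread t 0 m₁ i a lt a<N , butterfly-hull t 0 m₁
      (λ i lt → h i (≤-trans lt (m≤m+n N r))) i lt
    rest : ∀ i → i < r → lo ≤ y (N + i) × y (N + i) ≤ lo + W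
    rest i lt rewrite butterfly-fixed t 0 m₁ (N + i) (inj₂ (m≤m+n N i)) = h (N + i) (+-monoʳ-< N lt)
    paired : ∀ i → i < r → ∀ v → HalfSum v (y i) (y (N + i)) →
      pa + lo ≤ 2 * v + (4 * t + 8) × 2 * v ≤ pa + lo + (W + 12 * t + 8)
    paired i lt v (u , l) with block i (<-trans lt r<N) | rest i lt
    ... | pl , pu , _ , _ | rl , ru =
      (begin
        pa + lo                ≤⟨ +-mono-≤ pl rl ⟩
        y i + y (N + i)        ≤⟨ l ⟩
        2 * v + 8              ≤⟨ +-monoʳ-≤ (2 * v) (m≤n+m 8 (4 * t)) ⟩
        2 * v + (4 * t + 8)    ∎) ,
      (begin
        2 * v                                ≤⟨ u ⟩
        y i + y (N + i) + 8                  ≤⟨ +-monoˡ-≤ 8 (+-mono-≤ pu ru) ⟩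
        pa + 8 * t + (lo + W) + 8            ≤⟨ m≤m+n _ (4 * t) ⟩
        pa + 8 * t + (lo + W) + 8 + 4 * t    ≡⟨ arith pa lo W t ⟩
        pa + lo + (W + 12 * t + 8)           ∎)
      where
      arith : ∀ p l w t → p + 8 * t + (l + w) + 8 + 4 * t ≡ p + l + (w + 12 * t + 8)
      arith = solve-∀
    alone : ∀ i → i < N → pa + lo ≤ 2 * y i + (4 * t + 8) × 2 * y i ≤ pa + lo + (W + 12 * t + 8)
    alone i lt with block i lt
    ... | pl , pu , hl , hu =
      (begin
        pa + lo                    ≤⟨ +-mono-≤ pl hl ⟩
        y i + (y i + 4 * t)        ≤⟨ m≤m+n _ 8 ⟩
        y i + (y i + 4 * t) + 8    ≡⟨ arith₁ (y i) t ⟩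
        2 * y i + (4 * t + 8)      ∎) ,
      (begin
        2 * y i                                ≡⟨ cong (y i +_) (+-identityʳ (y i)) ⟩
        y i + y i                              ≤⟨ +-mono-≤ pu hu ⟩
        pa + 8 * t + (lo + W + 4 * t)          ≤⟨ m≤m+n _ 8 ⟩
        pa + 8 * t + (lo + W + 4 * t) + 8      ≡⟨ arith₂ pa lo W t ⟩
        pa + lo + (W + 12 * t + 8)             ∎)
      where
      arith₁ : ∀ y t → y + (y + 4 * t) + 8 ≡ 2 * y + (4 * t + 8)
      arith₁ = solve-∀
      arith₂ : ∀ p l w t → p + 8 * t + (l + w + 4 * t) + 8 ≡ p + l + (w + 12 * t + 8)
      arith₂ = solve-∀
    by : ∀ i → i < k → pa + lo ≤ 2 * z i + (4 * t + 8) × 2 * z i ≤ pa + lo + (W + 12 * t + 8)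
    by i i<k with i <? r
    ... | yes i<r = paired i i<r (z i) (proj₁ (sweep-halves 0 N r (<⇒≤ r<N) m₂ i i<r))
    ... | no i≮r with i <? N
    ...   | yes i<N rewrite sweep-fixed 0 N r m₂ i (inj₂ (inj₁ (≮⇒≥ i≮r , i<N))) (2^>0 t) = alone i i<N
    ...   | no i≮N = subst (λ j → pa + lo ≤ 2 * z j + (4 * t + 8) × 2 * z j ≤ pa + lo + (W + 12 * t + 8)) eq
        (paired (i ∸ N) j<r (z (N + (i ∸ N))) (proj₂ (sweep-halves 0 N r (<⇒≤ r<N) m₂ _ j<r)))
      where
      eq : N + (i ∸ N) ≡ i
      eq = m+[n∸m]≡n (≮⇒≥ i≮N)
      j<r : i ∸ N < r
      j<r = +-cancelˡ-< N _ _ (subst (_< k) (sym eq) i<k)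

  -- The fixed point of W ↦ (W + 16 t + 16) / 2, the effect of one round on the spread.
  limit : ℕ
  limit = 16 * t + 16

  -- The excess over `limit` is really about halved, but a decrease by one suffices because the
  -- number of rounds is free. Here twice the new spread is at most `2 * limit + suc X`, which is at
  -- most `2 * (limit + X) + 1`, and parity absorbs the last 1.
  round-spread : ∀ {x y} X → Moves round x y → Spread k (limit + suc X) x → Spread k (limit + X) y
  round-spread {x} {y} X m sp with round-hull m sp | minimum′ y (≤-trans (2^>0 t) (m≤m+n N r))
  ... | c , h | b , b<k , min = y b , λ i i<k → min i i<k , half-≤ (begin
    2 * y i                                                 ≤⟨ proj₂ (h i i<k) ⟩
    c + (limit + suc X + 12 * t + 8)                        ≤⟨ +-monoˡ-≤ _ (proj₁ (h b b<k)) ⟩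
    2 * y b + (4 * t + 8) + (limit + suc X + 12 * t + 8)    ≤⟨ m≤m+n _ X ⟩
    2 * y b + (4 * t + 8) + (limit + suc X + 12 * t + 8) + X ≡⟨ arith (y b) t X ⟩
    2 * (y b + (limit + X)) + 1                             ∎)
    where
    open ≤-Reasoning
    arith : ∀ y t X → 2 * y + (4 * t + 8) + (16 * t + 16 + suc X + 12 * t + 8) + X ≡ 2 * (y + (16 * t + 16 + X)) + 1
    arith = solve-∀

  rounds-spread : ∀ s {x y} → Moves (rounds s) x y → Spread k (limit + s) x → Spread k limit y
  rounds-spread zero {x} done = subst (λ W → Spread k W x) (+-identityʳ limit)
  rounds-spread (suc s) m sp with moves-++ round m
  ... | _ , m₁ , m₂ = rounds-spread s m₂ (round-spread s m₁ sp)

-- The schedule for k trees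

log-remainder : ∀ k → 0 < k → ∃₂ λ t r → k ≡ 2 ^ t + r × r < 2 ^ t
log-remainder 1 _ = 0 , 0 , refl , ≤-refl
log-remainder (suc k@(suc _)) _ with log-remainder k z<s
... | t , r , eq , lt with suc r <? 2 ^ t
...   | yes lt′ = t , suc r , trans (cong suc eq) (sym (+-suc _ r)) , lt′
...   | no ge = suc t , 0 , trans (cong suc eq) (trans (sym (+-suc _ r)) (trans (cong (2 ^ t +_) (trans
  (≤-antisym lt (≮⇒≥ ge)) (sym (+-identityʳ _)))) (sym (+-identityʳ _)))) , 2^>0 (suc t)

power-bound : ∀ t k {a} → 2 ^ t ≤ k → a ≤ t * 22 → 2 ^ a ≤ k ^ 22
power-bound t k {a} le a≤ = begin
  2 ^ a          ≤⟨ ^-monoʳ-≤ 2 a≤ ⟩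
  2 ^ (t * 22)   ≡⟨ ^-*-assoc 2 t 22 ⟨
  (2 ^ t) ^ 22   ≤⟨ ^-monoˡ-≤ 22 le ⟩
  k ^ 22         ∎
  where open ≤-Reasoning

-- For k = 3 and k = 5, 6, 7 the estimate log k ≥ t alone would not suffice.
limit-bound : ∀ t r k → 0 < r → r < 2 ^ t → k ≡ 2 ^ t + r → 2 ^ (16 * t + 16) ≤ k ^ 22
limit-bound 0 (suc r) _ _ (s≤s ()) _
limit-bound 1 r k r>0 _ eq = ≤-trans (toWitness {a? = 2 ^ 32 ≤? 3 ^ 22} _)
  (^-monoˡ-≤ 22 (≤-trans (+-monoʳ-≤ 2 r>0) (≤-reflexive (sym eq))))
limit-bound 2 r k r>0 _ eq = ≤-trans (toWitness {a? = 2 ^ 48 ≤? 5 ^ 22} _)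
  (^-monoˡ-≤ 22 (≤-trans (+-monoʳ-≤ 4 r>0) (≤-reflexive (sym eq))))
limit-bound t@(suc (suc (suc s))) r k _ _ eq =
  power-bound t k {16 * t + 16} (≤-trans (m≤m+n (2 ^ t) r) (≤-reflexive (sym eq)))
    (≤-trans (m≤m+n (16 * t + 16) (6 * s + 2)) (≤-reflexive (arith s)))
  where
  arith : ∀ s → 16 * (3 + s) + 16 + (6 * s + 2) ≡ (3 + s) * 22
  arith = solve-∀

-- The bound `M` on the initial entries is also the number of rounds, since each round lowers the
-- excess over `limit` by one. For a power of two a single butterfly is enough.
schedule : ∀ k → 0 < k → ∀ M → ∃₂ λ ps W → All (Valid k) ps × 2 ^ W ≤ k ^ 22 ×
  ∀ {x y} → (∀ i → x i ≤ M) → Moves ps x y → ∀ i j → i < k → j < k → y i ≤ y j + W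
schedule k k>0 M with log-remainder k k>0
... | t , zero , eq , _ =
  butterfly t 0 , 8 * t , butterfly-valid t 0 (≤-reflexive (sym eq′)) ,
  power-bound t k (≤-reflexive (sym eq′)) (≤-trans (*-monoˡ-≤ t (m≤m+n 8 14)) (≤-reflexive (*-comm 22 t))) ,
  λ _ m i j lti ltj → butterfly-spread t 0 m i j (subst (i <_) eq′ lti) (subst (j <_) eq′ ltj)
  where
  eq′ : k ≡ 2 ^ t
  eq′ = trans eq (+-identityʳ _)
... | t , r@(suc _) , eq , lt =
  rounds M , limit , subst (λ k → All (Valid k) (rounds M)) (sym eq) (rounds-valid M) , limit-bound t r k z<s lt eq ,
  λ x≤M m i j lti ltj → let lo , h = rounds-spread M m (0 , λ i _ → z≤n , ≤-trans (x≤M i) (m≤n+m M limit)) in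
    ≤-trans (proj₂ (h i (subst (i <_) eq lti))) (+-monoˡ-≤ limit (proj₁ (h j (subst (j <_) eq ltj))))
  where open Rounds t r lt

-- Labelled edges

map-↭ : ∀ {E : Set} (f : E → Pair n) {xs ys} → xs ↭ₚ ys → map f xs ↭ map f ys
map-↭ f p = Perm.map⁺ (setoid _) (unordered _) (λ { refl → same }) (↭⇒↭ₛ p)

infix 4 _≋_
_≋_ : Rel (Edges n) 0ℓ
_≋_ = Pointwise _≐_

≋⇒↭ : ∀ {L K : Edges n} → L ≋ K → L ↭ K
≋⇒↭ = SetoidPermutation.↭-reflexive-≋ (unordered _)

-- A redistributed list of pairs no longer tells which edges of the graph it consists of. Replaying
-- the permutation on the labels recovers them; parallel edges are interchangeable.
lift-labels : ∀ {E : Set} (f : E → Pair n) xs {L M} → L ↭ M → M ≋ map f xs → ∃ λ ys → ys ↭ₚ xs × L ≋ map f ys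
lift-labels f xs (Homogeneous.refl e) w = xs , ↭ₚ-refl , Pointwise.transitive (Setoid.trans (unordered _)) e w
lift-labels f (x ∷ xs) (Homogeneous.prep e p) (w ∷ ws) with lift-labels f xs p ws
... | ys , q , w′ = x ∷ ys , ↭ₚ-prep x q , Setoid.trans (unordered _) e w ∷ w′
lift-labels f (x ∷ y ∷ xs) (Homogeneous.swap e e′ p) (w ∷ w′ ∷ ws) with lift-labels f xs p ws
... | ys , q , ws′ = y ∷ x ∷ ys , ↭ₚ-swap y x q , Setoid.trans (unordered _) e w′ ∷ Setoid.trans (unordered _) e′ w ∷ ws′
lift-labels f xs (Homogeneous.trans p q) w with lift-labels f xs q w
... | ys , r , w′ with lift-labels f ys p w′
...   | zs , s , w″ = zs , ↭ₚ-trans s r , w″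

split-≋ : ∀ {E : Set} (f : E → Pair n) A {B} ys → A ++ B ≋ map f ys → ∃₂ λ as bs → ys ≡ as ++ bs × A ≋ map f as × B ≋ map f bs
split-≋ f [] ys w = [] , ys , refl , [] , w
split-≋ f (_ ∷ A) (y ∷ ys) (e ∷ w) with split-≋ f A ys w
... | as , bs , refl , wa , wb = y ∷ as , bs , refl , e ∷ wa , wb

lift-split : ∀ {E : Set} (f : E → Pair n) xs A {B} → A ++ B ↭ map f xs → ∃₂ λ as bs → as ++ bs ↭ₚ xs × A ↭ map f as × B ↭ map f bs
lift-split f xs A p with lift-labels f xs p (Pointwise.refl same)
... | ys , q , w with split-≋ f A ys w
...   | as , bs , refl , wa , wb = as , bs , q , ≋⇒↭ wa , ≋⇒↭ wb

-- Spanning trees of connected graphs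

-- Induction by contracting an edge at `zero`. The edges before contraction label their images, so
-- `lift-split` pulls the tree of the contracted graph back, and the contracted edge completes it.
spanning : ∀ n (L : Edges (suc n)) → Conn L → ∃₂ λ T R → T ++ R ↭ L × Tree T
spanning zero L c = [] , L , ↭-refl , (λ { zero zero → ε }) , refl
spanning (suc n) L c with leave (c zero (suc zero)) (λ ())
... | v , v≢0 , e with view zero v
...   | pivot = contradiction refl v≢0
...   | other x with ∈⇒↭ e
...     | K , p with spanning n (map φ₂ K) conn-K
  where
  φ = merge zero x
  φ₂ : Pair (2 + n) → Pair (suc n)
  φ₂ (a , b) = φ a , φ b
  conn-K : Conn (map φ₂ K)
  conn-K = contract zero x by (conn-↭ p c)
    where
    by : ∀ {a b} → (a , b) ∈ (zero , suc x) ∷ K → Reach (map φ₂ K) (φ a) (φ b)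
    by (here e) = merge-edge zero x e ε
    by (there e) = edge (Mem.∈-map⁺ (unordered _) (unordered _) (λ { same → same ; flip → flip }) e)
...       | T , R , q , c′ , l with lift-split (λ (a , b) → merge zero x a , merge zero x b) K T q
...         | T₀ , R₀ , r , wT , _ =
  (zero , suc x) ∷ T₀ , R₀ ,
  ↭-trans (↭-prep _ (subst₂ _↭_ (map-id _) (map-id _) (map-↭ id r))) (↭-sym p) ,
  expand zero x by (edge (here same)) (conn-↭ wT c′) ,
  cong suc (trans (cong suc (trans (sym (length-map _ T₀)) (sym (xs↭ys⇒|xs|≡|ys| wT)))) l)
  where
  φ = merge zero x
  retract : ∀ a → Reach ((zero , suc x) ∷ T₀) (suc (φ a)) a
  retract a with view zero a
  ... | pivot = edge (here flip)
  ... | other u rewrite merge-other zero x u = ε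
  by : ∀ {a b} → (a , b) ∈ map (λ (a , b) → φ a , φ b) T₀ → Reach ((zero , suc x) ∷ T₀) (suc a) (suc b)
  by e with Mem.∈-map⁻ (unordered _) (unordered _) e
  ... | (c , d) , e′ , eq with ≐-cases eq
  ...   | inj₁ (refl , refl) = retract c ◅◅ there e′ ◅ reach-sym (retract d)
  ...   | inj₂ (refl , refl) = retract d ◅◅ there (∈-≐ flip e′) ◅ reach-sym (retract c)

conn-length : ∀ {L : Edges n} → Conn L → n ≤ suc (length L)
conn-length {n = zero} c = z≤n
conn-length {n = suc n} {L} c with spanning n L c
... | T , R , p , _ , l = begin
  suc n                          ≡⟨ l ⟨
  suc (length T)                 ≤⟨ s≤s (m≤m+n (length T) (length R)) ⟩
  suc (length T + length R)      ≡⟨ cong suc (length-++ T) ⟨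
  suc (length (T ++ R))          ≡⟨ cong suc (xs↭ys⇒|xs|≡|ys| p) ⟩
  suc (length L)                 ∎
  where open ≤-Reasoning

-- Trees as edge sets

next-inject₁ : ∀ {l} (i : Fin l) → next (inject₁ i) ≡ suc i
next-inject₁ {l} i = Fin.toℕ-injective (trans (Fin.toℕ-fromℕ< _)
  (trans (m<n⇒m%n≡m (s≤s (subst (_< l) (sym (Fin.toℕ-inject₁ i)) (Fin.toℕ<n i)))) (cong suc (Fin.toℕ-inject₁ i))))

next-fromℕ : ∀ l → next (fromℕ l) ≡ zero
next-fromℕ l = Fin.toℕ-injective (trans (Fin.toℕ-fromℕ< _)
  (trans (cong (λ k → suc k % suc l) (Fin.toℕ-fromℕ l)) (n%n≡0 (suc l))))

module _ {n m : ℕ} (ends : Fin m → Pair (suc n)) where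

  private
    G : Graph
    G = record { n = suc n ; m = m ; ends = ends }

  joins⇒≐ : ∀ {e u w} → Joins G e u w → (u , w) ≐ ends e
  joins⇒≐ {e} (inj₁ (refl , refl)) = same
  joins⇒≐ {e} (inj₂ (refl , refl)) = flip

  ≐⇒joins : ∀ {e u w} → (u , w) ≐ ends e → Joins G e u w
  ≐⇒joins {e} eq with ≐-cases eq
  ... | inj₁ (refl , refl) = inj₁ (refl , refl)
  ... | inj₂ (refl , refl) = inj₂ (refl , refl)

  label : ∀ {e u w} es → e ∈ₚ es → Joins G e u w → (u , w) ∈ map ends es
  label es e∈es j = Any.map⁺ (Any.map (λ { refl → joins⇒≐ j }) e∈es)

  unlabel : ∀ {u w} es → (u , w) ∈ map ends es → ∃ λ e → e ∈ₚ es × Joins G e u w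
  unlabel es e with find (Any.map⁻ e)
  ... | e , e∈es , eq = e , e∈es , ≐⇒joins eq

  -- The length is an index so that vertices and edges can be read off as functions on `Fin`, the
  -- form that `Cycle` requires.
  data Path (es : List (Fin m)) : ℕ → Fin (suc n) → Fin (suc n) → Set where
    stop : ∀ {a} → Path es 0 a a
    step : ∀ {l b w a} e → e ∈ₚ es → Joins G e b w → Path es l w a → Path es (suc l) b a

  vert : ∀ {es l b a} → Path es l b a → Fin (suc l) → Fin (suc n)
  vert {b = b} _ zero = b
  vert (step _ _ _ p) (suc i) = vert p i

  arc : ∀ {es l b a} → Path es l b a → Fin l → Fin m
  arc (step e _ _ _) zero = e
  arc (step _ _ _ p) (suc i) = arc p i

  Simple : ∀ {es l b a} → Path es l b a → Set
  Simple stop = ⊤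
  Simple (step {b = b} _ _ _ p) = (∀ i → vert p i ≢ b) × Simple p

  vert-fromℕ : ∀ {es l b a} (p : Path es l b a) → vert p (fromℕ l) ≡ a
  vert-fromℕ stop = refl
  vert-fromℕ (step _ _ _ p) = vert-fromℕ p

  vert-injective : ∀ {es l b a} (p : Path es l b a) → Simple p → ∀ {i j} → vert p i ≡ vert p j → i ≡ j
  vert-injective p s {zero} {zero} _ = refl
  vert-injective (step _ _ _ p) (fresh , _) {zero} {suc j} eq = contradiction (sym eq) (fresh j)
  vert-injective (step _ _ _ p) (fresh , _) {suc i} {zero} eq = contradiction eq (fresh i)
  vert-injective (step _ _ _ p) (_ , s) {suc i} {suc j} eq = cong suc (vert-injective p s eq)

  arc-∈ : ∀ {es l b a} (p : Path es l b a) i → arc p i ∈ₚ es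
  arc-∈ (step _ e _ _) zero = e
  arc-∈ (step _ _ _ p) (suc i) = arc-∈ p i

  arc-joins : ∀ {es l b a} (p : Path es l b a) i → Joins G (arc p i) (vert p (inject₁ i)) (vert p (suc i))
  arc-joins (step _ _ j p) zero = j
  arc-joins (step _ _ _ p@stop) (suc ())
  arc-joins (step _ _ _ p@(step _ _ _ _)) (suc i) = arc-joins p i

  -- If the first edge recurred later, its end `b` would be visited a second time.
  arc-injective : ∀ {es l b a} (p : Path es l b a) → Simple p → ∀ {i j} → arc p i ≡ arc p j → i ≡ j
  arc-injective (step _ _ _ _) _ {zero} {zero} _ = refl
  arc-injective (step e _ j p) s {zero} {suc i} eq = contradiction (sym eq) (arc-fresh j p (proj₁ s) i)
    where
    arc-fresh : ∀ {es l e b w w′ a} → Joins G e b w → (p : Path es l w′ a) → (∀ i → vert p i ≢ b) → ∀ i → arc p i ≢ e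
    arc-fresh j p fresh i refl with arc-joins p i | j
    ... | inj₁ (x , _) | inj₁ (y , _) = fresh (inject₁ i) (trans (sym x) y)
    ... | inj₁ (_ , x) | inj₂ (_ , y) = fresh (suc i) (trans (sym x) y)
    ... | inj₂ (x , _) | inj₁ (y , _) = fresh (suc i) (trans (sym x) y)
    ... | inj₂ (_ , x) | inj₂ (_ , y) = fresh (inject₁ i) (trans (sym x) y)
  arc-injective (step e x j p) s {suc i} {zero} eq = sym (arc-injective (step e x j p) s {zero} {suc i} (sym eq))
  arc-injective (step _ _ _ p) (_ , s) {suc i} {suc j} eq = cong suc (arc-injective p s eq)

  suffix : ∀ {es l b a} (p : Path es l b a) → Simple p → ∀ i → ∃₂ λ l′ (q : Path es l′ (vert p i) a) → Simple q
  suffix p s zero = _ , p , s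
  suffix (step _ _ _ p) (_ , s) (suc i) = suffix p s i

  -- If the new starting vertex already lies on the simple path, the part before it is cut off.
  simple-path : ∀ {es b a} → Reach (map ends es) b a → ∃₂ λ l (p : Path es l b a) → Simple p
  simple-path ε = 0 , stop , tt
  simple-path {es} {b} (e ◅ r) with simple-path {es} r
  ... | l , p , s with Fin.any? (λ i → vert p i ≟ b)
  ...   | yes (i , refl) = suffix p s i
  ...   | no fresh = let e , e∈es , j = unlabel es e in suc l , step e e∈es j p , (λ i eq → fresh (i , eq)) , s

  -- The edge `r` gets the last index, where `next` wraps around to zero. A path of length 0 yields
  -- a loop and one of length 1 a pair of parallel edges, both of which count as cycles.
  close-cycle : ∀ {S es a b r} → (∀ {e} → e ∈ₚ es → S e ≡ true) → S r ≡ true → r ∉ₚ es → Joins G r a b →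
    Reach (map ends es) b a → Cycle G S
  close-cycle {S} {es} {a} {b} {r} es⊆S Sr r∉es j reach with simple-path {es} reach
  ... | l , p , s = record
    { l = l ; vs = vert p ; es = arcs ; vsInj = vert-injective p s ; esInj = inj ; esInS = in-S ; join = join }
    where
    arcs : Fin (suc l) → Fin m
    arcs i with Top.view i
    ... | ‵fromℕ = r
    ... | ‵inject₁ i = arc p i
    inj : ∀ {i j} → arcs i ≡ arcs j → i ≡ j
    inj {i} {j} eq with Top.view i | Top.view j
    ... | ‵fromℕ | ‵fromℕ = refl
    ... | ‵fromℕ | ‵inject₁ j = contradiction (subst (_∈ₚ es) (sym eq) (arc-∈ p j)) r∉es
    ... | ‵inject₁ i | ‵fromℕ = contradiction (subst (_∈ₚ es) eq (arc-∈ p i)) r∉es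
    ... | ‵inject₁ i | ‵inject₁ j = cong inject₁ (arc-injective p s eq)
    in-S : ∀ i → S (arcs i) ≡ true
    in-S i with Top.view i
    ... | ‵fromℕ = Sr
    ... | ‵inject₁ i = es⊆S (arc-∈ p i)
    join : ∀ i → Joins G (arcs i) (vert p i) (vert p (next i))
    join i with Top.view i
    ... | ‵fromℕ rewrite next-fromℕ l | vert-fromℕ p = j
    ... | ‵inject₁ i rewrite next-inject₁ i = arc-joins p i

  _Lists_ : List (Fin m) → EdgeSet G → Set
  es Lists S = ∀ e → e ∈ₚ es ⇔ S e ≡ true

  connected⇒conn : ∀ {S es} → es Lists S → Connected G S → Conn (map ends es)
  connected⇒conn {S} {es} h c u v = reach (c u v)
    where
    reach : ∀ {u v} → Walk G S u v → Reach (map ends es) u v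
    reach [] = ε
    reach (step e Se j w) = label es (Equivalence.from (h e) Se) j ◅ reach w

  conn⇒connected : ∀ {S es} → es Lists S → Conn (map ends es) → Connected G S
  conn⇒connected {S} {es} h c u v = walk (c u v)
    where
    walk : ∀ {u v} → Reach (map ends es) u v → Walk G S u v
    walk ε = []
    walk (e ◅ r) = let e , e∈es , j = unlabel es e in step e (Equivalence.to (h e) e∈es) j (walk r)

  -- A spanning tree is extracted from the connected list. Any leftover edge would close a cycle
  -- with a path in it, so the extracted tree is everything.
  spanningTree⇒tree : ∀ {S es} → Unique es → es Lists S → SpanningTree G S → Tree (map ends es)
  spanningTree⇒tree {S} {es} uniq h (c , acyclic) with spanning n (map ends es) (connected⇒conn h c)
  ... | T , R , p , t with lift-split ends es T p
  ...   | ts , [] , q , wT , _ = tree-↭ (↭-trans wT (map-↭ ends (subst (_↭ₚ es) (++-identityʳ ts) q))) t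
  ...   | ts , r ∷ rs , q , wT , _ = contradiction cycle acyclic
    where
    in-S : ∀ {e} → e ∈ₚ ts ++ r ∷ rs → S e ≡ true
    in-S e = Equivalence.to (h _) (Permₚ.∈-resp-↭ q e)
    r∉ts : r ∉ₚ ts
    r∉ts r∈ts with Perm.Unique-resp-↭ (setoid _) (↭⇒↭ₛ (↭ₚ-trans (↭ₚ-sym q) (Permₚ.shift r ts rs))) uniq
    ... | fresh ∷ _ = All.lookup fresh (Memₚ.∈-++⁺ˡ r∈ts) refl
    cycle : Cycle G S
    cycle = close-cycle {es = ts} (in-S ∘ Memₚ.∈-++⁺ˡ) (in-S (Memₚ.∈-++⁺ʳ ts (here refl))) r∉ts (inj₁ (refl , refl))
      (conn-↭ wT (proj₁ t) _ _)

  -- Deleting an edge of a cycle preserves connectedness, because its ends stay joined by the rest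
  -- of the cycle; but then too few edges remain for `conn-length`.
  tree⇒acyclic : ∀ {S es} → es Lists S → Tree (map ends es) → Acyclic G S
  tree⇒acyclic {S} {es} h (c , l) C with Memₚ.∈-∃++ (Equivalence.from (h _) (Cycle.esInS C zero))
  ... | as , bs , refl = <-irrefl refl (≤-trans (≤-reflexive len) (conn-length conn))
    where
    open Cycle C using (vs; join; esInS; esInj) renaming (l to k; es to cs)
    rest = as ++ bs
    whole : as ++ cs zero ∷ bs ↭ₚ cs zero ∷ rest
    whole = Permₚ.shift (cs zero) as bs
    len : suc (suc (length (map ends rest))) ≡ suc n
    len = trans (cong suc (sym (xs↭ys⇒|xs|≡|ys| (map-↭ ends whole)))) l
    in-rest : ∀ j → cs (suc j) ∈ₚ rest
    in-rest j with Permₚ.∈-resp-↭ whole (Equivalence.from (h _) (esInS (suc j)))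
    ... | here eq = contradiction (esInj eq) λ ()
    ... | there e = e
    around : ∀ i → Reach (map ends rest) (vs (next zero)) (vs (next i))
    around = <-weakInduction (λ i → Reach (map ends rest) (vs (next zero)) (vs (next i))) ε λ j r →
      r ◅◅ edge (subst (λ i → (vs i , vs (next (suc j))) ∈ map ends rest) (sym (next-inject₁ j))
        (label rest (in-rest j) (join (suc j))))
    back : Reach (map ends rest) (vs zero) (vs (next zero))
    back = reach-sym (subst (λ i → Reach (map ends rest) (vs (next zero)) (vs i)) (next-fromℕ k) (around (fromℕ k)))
    conn : Conn (map ends rest)
    conn a b = reach-⊆ by (conn-↭ (map-↭ ends whole) c a b)
      where
      by : ∀ {a b} → (a , b) ∈ map ends (cs zero ∷ rest) → Reach (map ends rest) a b
      by (there e) = edge e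
      by (here e) with ≐-cases (Setoid.trans (unordered _) e (Setoid.sym (unordered _) (joins⇒≐ (join zero))))
      ... | inj₁ (refl , refl) = back
      ... | inj₂ (refl , refl) = reach-sym back

  tree⇒spanningTree : ∀ {S es} → es Lists S → Tree (map ends es) → SpanningTree G S
  tree⇒spanningTree h t = conn⇒connected h (proj₁ t) , tree⇒acyclic h t

-- Factorizations as edge colourings

unique-↭ : ∀ {E : Set} {xs ys : List E} → Unique xs → Unique ys → (∀ e → e ∈ₚ xs ⇔ e ∈ₚ ys) → xs ↭ₚ ys
unique-↭ u w h = ∼bag⇒↭ (unique∧set⇒bag u w (h _))

sum-filter : ∀ {E : Set} {P : E → Set} (P? : ∀ e → Dec (P e)) (f : E → ℕ) es →
  sum (map (λ e → if does (P? e) then f e else 0) es) ≡ sum (map f (filter P? es))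
sum-filter P? f [] = refl
sum-filter P? f (e ∷ es) with does (P? e)
... | true = cong (f e +_) (sum-filter P? f es)
... | false = sum-filter P? f es

deg≤ : ∀ (L : Edges n) w → deg L w ≤ 2 * length L
deg≤ [] w = z≤n
deg≤ ((a , b) ∷ L) w = ≤-trans (+-mono-≤ (+-mono-≤ (at≤1 a) (at≤1 b)) (deg≤ L w)) (≤-reflexive (sym (*-suc 2 (length L))))
  where
  at≤1 : ∀ a → at a w 1 ≤ 1
  at≤1 a with does (a ≟ w)
  ... | true = ≤-refl
  ... | false = z≤n

does⇔ : ∀ {P : Set} (P? : Dec P) → P ⇔ does P? ≡ true
does⇔ (yes p) = mk⇔ (λ _ → refl) (λ _ → p)
does⇔ (no ¬p) = mk⇔ (λ p → contradiction p ¬p) λ ()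

module _ {n m : ℕ} (ends : Fin m → Pair (suc n)) (k : ℕ) where

  class : (Fin m → ℕ) → ℕ → List (Fin m)
  class c i = filter (λ e → c e ≟ℕ i) (allFin m)

  ∈-class : ∀ c {i e} → e ∈ₚ class c i ⇔ c e ≡ i
  ∈-class c {i} {e} = mk⇔ (λ e∈ → proj₂ (Memₚ.∈-filter⁻ (λ e → c e ≟ℕ i) {xs = allFin m} e∈))
    (Memₚ.∈-filter⁺ (λ e → c e ≟ℕ i) (Memₚ.∈-allFin e))

  class-unique : ∀ c i → Unique (class c i)
  class-unique c i = Unique.filter⁺ (λ e → c e ≟ℕ i) (Unique.allFin⁺ m)

  classDeg : (Fin m → ℕ) → Fin (suc n) → ℕ → ℕ
  classDeg c v i = deg (map ends (class c i)) v

  classDeg≤ : ∀ c v i → classDeg c v i ≤ 2 * m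
  classDeg≤ c v i = ≤-trans (deg≤ (map ends (class c i)) v) (*-monoʳ-≤ 2 (begin
    length (map ends (class c i))  ≡⟨ length-map ends (class c i) ⟩
    length (class c i)             ≤⟨ length-filter (λ e → c e ≟ℕ i) (allFin m) ⟩
    length (allFin m)              ≡⟨ length-tabulate id ⟩
    m                              ∎))
    where open ≤-Reasoning

  record Factorization (c : Fin m → ℕ) : Set where
    field
      bounded : ∀ e → c e < k
      tree : ∀ i → i < k → Tree (map ends (class c i))

  module Recolour {c i j} (F : Factorization c) (i<j : i < j) (j<k : j < k) {A B : Edges (suc n)}
    (treeA : Tree A) (treeB : Tree B) (perm : A ++ B ↭ map ends (class c i) ++ map ends (class c j))
    (close : ∀ u → Close (deg A u) (deg B u)) (as bs : List (Fin m)) (q : as ++ bs ↭ₚ class c i ++ class c j)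
    (pA : A ↭ map ends as) (pB : B ↭ map ends bs) where

    open Factorization F
    _∈?_ : ∀ (e : Fin m) es → Dec (e ∈ₚ es)
    _∈?_ = DecMembership._∈?_ _≟_

    uniq : Unique (as ++ bs)
    uniq = Perm.Unique-resp-↭ (setoid _) (↭⇒↭ₛ (↭ₚ-sym q)) (Unique.++⁺ (class-unique c i) (class-unique c j)
      λ (x , y) → <⇒≢ i<j (trans (sym (Equivalence.to (∈-class c) x)) (Equivalence.to (∈-class c) y)))

    split-unique : ∀ xs {ys : List (Fin m)} → Unique (xs ++ ys) → Unique xs × Unique ys × (∀ {e} → e ∈ₚ xs → e ∉ₚ ys)
    split-unique [] u = [] , u , λ ()
    split-unique (x ∷ xs) (x∉ ∷ u) with split-unique xs u
    ... | ux , uy , disjoint = All.++⁻ˡ xs x∉ ∷ ux , uy , λ { (here refl) e∈ys → All.lookup (All.++⁻ʳ xs x∉) e∈ys refl ; (there e∈) → disjoint e∈ }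

    disjoint : ∀ {e} → e ∈ₚ as → e ∉ₚ bs
    disjoint = proj₂ (proj₂ (split-unique as uniq))

    old : ∀ {e} → e ∈ₚ as ⊎ e ∈ₚ bs → c e ≡ i ⊎ c e ≡ j
    old h with Memₚ.∈-++⁻ (class c i) (Permₚ.∈-resp-↭ q ([ Memₚ.∈-++⁺ˡ , Memₚ.∈-++⁺ʳ as ]′ h))
    ... | inj₁ e = inj₁ (Equivalence.to (∈-class c) e)
    ... | inj₂ e = inj₂ (Equivalence.to (∈-class c) e)

    new : ∀ {e} → c e ≡ i ⊎ c e ≡ j → e ∈ₚ as ⊎ e ∈ₚ bs
    new h = Memₚ.∈-++⁻ as (Permₚ.∈-resp-↭ (↭ₚ-sym q)
      ([ Memₚ.∈-++⁺ˡ ∘ Equivalence.from (∈-class c) , Memₚ.∈-++⁺ʳ (class c i) ∘ Equivalence.from (∈-class c) ]′ h))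

    c′ : Fin m → ℕ
    c′ e with e ∈? as | e ∈? bs
    ... | yes _ | _ = i
    ... | no _ | yes _ = j
    ... | no _ | no _ = c e

    c′-as : ∀ e → e ∈ₚ as ⇔ c′ e ≡ i
    c′-as e with e ∈? as | e ∈? bs
    ... | yes e∈ | _ = mk⇔ (λ _ → refl) (λ _ → e∈)
    ... | no e∉ | yes _ = mk⇔ (λ e∈ → contradiction e∈ e∉) (λ eq → contradiction (sym eq) (<⇒≢ i<j))
    ... | no e∉ | no e∉′ = mk⇔ (λ e∈ → contradiction e∈ e∉) (λ eq → [ id , (λ e∈ → contradiction e∈ e∉′) ]′ (new (inj₁ eq)))

    c′-bs : ∀ e → e ∈ₚ bs ⇔ c′ e ≡ j
    c′-bs e with e ∈? as | e ∈? bs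
    ... | yes e∈ | _ = mk⇔ (λ e∈′ → contradiction e∈′ (disjoint e∈)) (λ eq → contradiction eq (<⇒≢ i<j))
    ... | no e∉ | yes e∈ = mk⇔ (λ _ → refl) (λ _ → e∈)
    ... | no e∉ | no e∉′ = mk⇔ (λ e∈ → contradiction e∈ e∉′) (λ eq → [ (λ e∈ → contradiction e∈ e∉) , id ]′ (new (inj₂ eq)))

    c′-other : ∀ {l} → l ≢ i → l ≢ j → ∀ e → e ∈ₚ class c l ⇔ c′ e ≡ l
    c′-other l≢i l≢j e with e ∈? as | e ∈? bs
    ... | yes e∈ | _ = mk⇔ (λ e∈l → contradiction (Equivalence.to (∈-class c) e∈l) (λ eq → [ l≢i ∘ trans
      (sym eq) , l≢j ∘ trans (sym eq) ]′ (old (inj₁ e∈)))) (λ eq → contradiction (sym eq) l≢i)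
    ... | no _ | yes e∈ = mk⇔ (λ e∈l → contradiction (Equivalence.to (∈-class c) e∈l) (λ eq → [ l≢i ∘ trans
      (sym eq) , l≢j ∘ trans (sym eq) ]′ (old (inj₂ e∈)))) (λ eq → contradiction (sym eq) l≢j)
    ... | no _ | no _ = ∈-class c

    -- Both lists are free of repetitions, so equal membership already makes them permutations of
    -- each other.
    class′ : ∀ {l es} → Unique es → (∀ e → e ∈ₚ es ⇔ c′ e ≡ l) → map ends es ↭ map ends (class c′ l)
    class′ u h = map-↭ ends (unique-↭ u (class-unique c′ _) λ e →
      mk⇔ (Equivalence.from (∈-class c′) ∘ Equivalence.to (h e)) (Equivalence.from (h e) ∘ Equivalence.to (∈-class c′)))

    at-i : A ↭ map ends (class c′ i)
    at-i = ↭-trans pA (class′ (proj₁ (split-unique as uniq)) c′-as)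

    at-j : B ↭ map ends (class c′ j)
    at-j = ↭-trans pB (class′ (proj₁ (proj₂ (split-unique as uniq))) c′-bs)

    at-other : ∀ {l} → l ≢ i → l ≢ j → map ends (class c l) ↭ map ends (class c′ l)
    at-other l≢i l≢j = class′ (class-unique c _) (c′-other l≢i l≢j)

    bounded′ : ∀ e → c′ e < k
    bounded′ e with e ∈? as | e ∈? bs
    ... | yes _ | _ = <-trans i<j j<k
    ... | no _ | yes _ = j<k
    ... | no _ | no _ = bounded e

    tree′ : ∀ l → l < k → Tree (map ends (class c′ l))
    tree′ l l<k with l ≟ℕ i | l ≟ℕ j
    ... | yes refl | _ = tree-↭ at-i treeA
    ... | no _ | yes refl = tree-↭ at-j treeB
    ... | no l≢i | no l≢j = tree-↭ (at-other l≢i l≢j) (tree l l<k)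

    averages : ∀ v → Averaging i j (classDeg c v) (classDeg c′ v)
    averages v = averaging
      (trans (cong₂ _+_ (sym (nb-↭ _ v at-i)) (sym (nb-↭ _ v at-j)))
        (trans (sym (nb-++ _ A B v)) (trans (nb-↭ _ v perm) (nb-++ _ (map ends (class c i)) _ v))))
      (subst₂ Close (nb-↭ _ v at-i) (nb-↭ _ v at-j) (close v))
      λ l l≢i l≢j → sym (nb-↭ _ v (at-other l≢i l≢j))

  module _ {c i j} (F : Factorization c) (i<j : i < j) (j<k : j < k) where

    Rebalanced : Set
    Rebalanced = ∃ λ c′ → Factorization c′ × ∀ v → Averaging i j (classDeg c v) (classDeg c′ v)

    recolour : Balanced (map ends (class c i)) (map ends (class c j)) → Rebalanced
    recolour (balanced {A} {B} s t p close) = go (lift-split ends (class c i ++ class c j) A (↭-trans p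
      (↭-reflexive (sym (map-++ ends (class c i) (class c j))))))
      where
      go : (∃₂ λ as bs → as ++ bs ↭ₚ class c i ++ class c j × A ↭ map ends as × B ↭ map ends bs) → Rebalanced
      go (as , bs , q , pA , pB) = c′ , record { bounded = bounded′ ; tree = tree′ } , averages
        where open Recolour F i<j j<k s t p close as bs q pA pB

    rebalance : Rebalanced
    rebalance = recolour (balance n (Factorization.tree F i (<-trans i<j j<k)) (Factorization.tree F j j<k))

  perform : ∀ {c} ps → All (Valid k) ps → Factorization c →
    ∃ λ c′ → Factorization c′ × ∀ v → Moves ps (classDeg c v) (classDeg c′ v)
  perform {c} [] [] F = c , F , λ _ → done
  perform (_ ∷ ps) ((i<j , j<k) ∷ valid) F =
    let _ , F₁ , s = rebalance F i<j j<k
        c₂ , F₂ , m = perform ps valid F₁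
    in c₂ , F₂ , λ v → move (s v) (m v)

  private
    G : Graph
    G = record { n = suc n ; m = m ; ends = ends }

  colour : ((T , _ , _ , cover) : MultipleTree k G) → Fin m → ℕ
  colour (_ , _ , _ , cover) e = toℕ (proj₁ (cover e))

  colour-factorization : (T : MultipleTree k G) → Factorization (colour T)
  colour-factorization T@(S , trees , disjoint , cover) = record
    { bounded = λ e → Fin.toℕ<n (proj₁ (cover e))
    ; tree = λ i i<k → subst (λ i → Tree (map ends (class (colour T) i))) (Fin.toℕ-fromℕ< i<k) (tree (fromℕ< i<k))
    }
    where
    tree : ∀ i → Tree (map ends (class (colour T) (toℕ i)))
    tree i = spanningTree⇒tree ends (class-unique (colour T) (toℕ i)) lists (trees i)
      where
      lists : ∀ e → e ∈ₚ class (colour T) (toℕ i) ⇔ S i e ≡ true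
      lists e = mk⇔
        (λ e∈ → subst (λ i → S i e ≡ true) (Fin.toℕ-injective (Equivalence.to (∈-class (colour T)) e∈)) (proj₂ (cover e)))
        (λ Se → Equivalence.from (∈-class (colour T)) (cong toℕ (disjoint _ _ e (proj₂ (cover e)) Se)))

  classSet : (Fin m → ℕ) → Fin k → EdgeSet G
  classSet c i e = does (c e ≟ℕ toℕ i)

  classSet-factorization : ∀ {c} → Factorization c → IsSpanningTreeFactorization G k (classSet c)
  classSet-factorization {c} F =
    (λ i → tree⇒spanningTree ends (lists i) (tree (toℕ i) (Fin.toℕ<n i))) ,
    (λ i j e Ti Tj → Fin.toℕ-injective (trans (sym (Equivalence.from (in-class i e) Ti)) (Equivalence.from
      (in-class j e) Tj))) ,
    λ e → fromℕ< (bounded e) , Equivalence.to (in-class _ e) (sym (Fin.toℕ-fromℕ< (bounded e)))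
    where
    open Factorization F
    in-class : ∀ i e → c e ≡ toℕ i ⇔ classSet c i e ≡ true
    in-class i e = does⇔ (c e ≟ℕ toℕ i)
    lists : ∀ i e → e ∈ₚ class c (toℕ i) ⇔ classSet c i e ≡ true
    lists i e = mk⇔ (Equivalence.to (in-class i e) ∘ Equivalence.to (∈-class c))
      (Equivalence.from (∈-class c) ∘ Equivalence.from (in-class i e))

  degree-classSet : ∀ c i v → degree G (classSet c i) v ≡ classDeg c v (toℕ i)
  degree-classSet c i v = trans (sum-filter (λ e → c e ≟ℕ toℕ i) (endsAt G v) (allFin m))
    (cong sum (map-∘ (class c (toℕ i))))

-- The bound on the degree differences

∣-∣≤ : ∀ a b {W} → a ≤ b + W → b ≤ a + W → ∣ a - b ∣ ≤ W
∣-∣≤ zero b _ le = le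
∣-∣≤ (suc a) zero le _ = le
∣-∣≤ (suc a) (suc b) (s≤s p) (s≤s q) = ∣-∣≤ a b p q

theorem3 : (k : ℕ) → 1 ≤ k → (G : Graph) → MultipleTree k G →
    Σ (Fin k → EdgeSet G) λ T → IsSpanningTreeFactorization G k T ×
    (∀ (v : Vertex G) (i j : Fin k) →
    ≤-c*log₂ ∣ degree G (T i) v - degree G (T j) v ∣ 22 k)
-- Without vertices the given factorization is returned: `Tree` demands one vertex more than edges,
-- so it cannot describe this case.
theorem3 k _ record { n = zero } (T , F) = T , F , λ ()
theorem3 k k≥1 G@record { n = suc n ; m = m ; ends = ends } T =
  -- A class has at most `m` edges, and each adds at most 2 to a degree.
  let ps , W , valid , W-bound , spread = schedule k k≥1 (2 * m)
      c , F , moves = perform ends k ps valid (colour-factorization ends k T)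
      apart : ∀ v i j → degree G (classSet ends k c i) v ≤ degree G (classSet ends k c j) v + W
      apart v i j = subst₂ (λ a b → a ≤ b + W) (sym (degree-classSet ends k c i v)) (sym (degree-classSet ends k c j v))
        (spread (classDeg≤ ends k _ v) (moves v) (toℕ i) (toℕ j) (Fin.toℕ<n i) (Fin.toℕ<n j))
  in classSet ends k c , classSet-factorization ends k F ,
     λ v i j → ≤-trans (^-monoʳ-≤ 2 (∣-∣≤ (degree G (classSet ends k c i) v) _ (apart v i j) (apart v j i))) W-bound
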